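{- Suppose $c\ge 2$, $n\ge 3$, $\frac{c-1}{2(c+1)}n>R>\sqrt{n\ln\left(\frac{c}{c-1}\right)}$, and let $r_1,\ldots,r_k$ be distinct integers with $|n/2-r_i|\le R$ for all $i$. Let $X_*$ be a Lipschitz function over $\{0,1\}^n$, and let $X$ be $X_*$ restricted to $C_{r_1,\ldots,r_k}$. Then for every $h\ge 0$, $$\mathbb{P}\big(X-\mathbb{E}(X_*)\ge h\big)<e^{(R+3)\ln(c)-\ln(k)-\frac{h^2}{2(n-1)}}.$$ In particular, if $n/6>R>\sqrt{n\ln(2)}$, then for every $h\ge0$, $$\mathbb{P}\big(X-\mathbb{E}(X_*)\ge h\big)<e^{(R+3)\ln(2)-\ln(k)-\frac{h^2}{2(n-1)}}.$$
   Context: Elements of $\{0,1\}^n$ are identified with subsets of $\{1,\ldots,n\}$, with the metric $d(A,B)=|A\triangle B|$ (Hamming distance). A function $X_*:\{0,1\}^n\to\mathbb{R}$ is Lipschitz if $|X_*(A)-X_*(B)|\le d(A,B)$ for all $A,B$. For an integer $s$, $C_s=\{A\in\{0,1\}^n:|A|=s\}$, and $C_{r_1,\ldots,r_k}=\bigcup_iC_{r_i}$. The function $X_*$ is regarded as a random variable under the uniform distribution on $\{0,1\}^n$ (so $\mathbb{E}(X_*)$ is its average over $\{0,1\}^n$), and $X$ as a random variable under the uniform distribution on $C_{r_1,\ldots,r_k}$. -}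

module Defs where

open import Algebra.Bundles using (CommutativeRing; Semiring)
import Algebra.Construct.NaturalChoice.Max as Max
import Algebra.Definitions.RawSemiring as RawSemiringDefs
open import Data.Fin using (Fin)
open import Data.Fin.Properties using (any?)
open import Data.Fin.Subset using (Subset; inside; outside; _∪_; _─_; ∣_∣)
open import Data.Integer as ℤ using (ℤ; +_; -[1+_])
open import Data.List using (List; []; _∷_; _++_; map; filter; foldr; length)
open import Data.Nat as ℕ using (ℕ; zero; suc)
open import Data.Product using (_×_; ∃; ∃-syntax)
open import Data.Vec using ([]; _∷_)
open import Level using (0ℓ)
open import Relation.Binary.Bundles using (DecTotalOrder)
import Relation.Binary.Construct.NonStrictToStrict as NonStrictToStrict
open import Relation.Binary.PropositionalEquality using (_≡_)
open import Relation.Binary.Structures using (IsDecTotalOrder)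
open import Relation.Nullary using (¬_)
open import Relation.Unary using (Pred; Decidable)

-- The real numbers of classical analysis, characterised up to isomorphism as a
-- complete ordered field.  Decidability of the order is the classical reading;
-- under excluded middle, Dedekind cuts (as maps ℚ → Bool) form such a field.
-- The value of 0# ⁻¹ is unspecified.

record CompleteOrderedField : Set₁ where
  field
    commutativeRing : CommutativeRing 0ℓ 0ℓ
  open CommutativeRing commutativeRing public renaming (Carrier to ℝ)

  infix  4 _≤_
  infix  8 _⁻¹
  field
    _≤_             : ℝ → ℝ → Set
    isDecTotalOrder : IsDecTotalOrder _≈_ _≤_
    +-mono-≤        : ∀ {x y} z → x ≤ y → (x + z) ≤ (y + z)
    *-nonneg        : ∀ {x y} → 0# ≤ x → 0# ≤ y → 0# ≤ (x * y)
    0≉1             : ¬ (0# ≈ 1#)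
    _⁻¹             : ℝ → ℝ
    ⁻¹-cong         : ∀ {x y} → x ≈ y → (x ⁻¹) ≈ (y ⁻¹)
    ⁻¹-inverse      : ∀ x → ¬ (x ≈ 0#) → (x * x ⁻¹) ≈ 1#
    supremum        : (P : ℝ → Set) → ∃ P → (∃[ b ] (∀ x → P x → x ≤ b)) →
                      ∃[ s ] (∀ x → P x → x ≤ s) ×
                             (∀ b → (∀ x → P x → x ≤ b) → s ≤ b)

  decTotalOrder : DecTotalOrder 0ℓ 0ℓ 0ℓ
  decTotalOrder = record { isDecTotalOrder = isDecTotalOrder }

  open IsDecTotalOrder isDecTotalOrder public using (_≤?_)
  open NonStrictToStrict _≈_ _≤_ public using (_<_)
  open Max (DecTotalOrder.totalOrder decTotalOrder) public using (_⊔_)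
  open RawSemiringDefs (Semiring.rawSemiring semiring) public
    using (_^_) renaming (_×_ to _·_)

  infixl 7 _/_
  _/_ : ℝ → ℝ → ℝ
  x / y = x * y ⁻¹

  abs : ℝ → ℝ
  abs x = x ⊔ (- x)

  fromℕ : ℕ → ℝ
  fromℕ n = n · 1#

  fromℤ : ℤ → ℝ
  fromℤ (+ n)    = fromℕ n
  fromℤ -[1+ n ] = - fromℕ (suc n)

  ConvergesTo : (ℕ → ℝ) → ℝ → Set
  ConvergesTo u l = ∀ ε → 0# < ε → ∃[ N ] (∀ m → N ℕ.≤ m → abs (u m - l) < ε)

-- Each function is determined by its law on the stated domain (exp x is the
-- limit of (1 + x/m)ᵐ, indexed here from m = 1); ln and √ are total functions
-- whose values outside their domains are unspecified.

record ExpLnSqrt (F : CompleteOrderedField) : Set where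
  open CompleteOrderedField F
  field
    exp    : ℝ → ℝ
    exp-def : ∀ x → ConvergesTo (λ m → (1# + x / fromℕ (suc m)) ^ suc m) (exp x)
    ln     : ℝ → ℝ
    exp-ln : ∀ x → 0# < x → exp (ln x) ≈ x
    √      : ℝ → ℝ
    √-nonneg : ∀ x → 0# ≤ x → 0# ≤ √ x
    √-square : ∀ x → 0# ≤ x → (√ x * √ x) ≈ x

hamming : ∀ {n} → Subset n → Subset n → ℕ
hamming A B = ∣ (A ─ B) ∪ (B ─ A) ∣

cube : ∀ n → List (Subset n)
cube zero    = [] ∷ []
cube (suc n) = map (outside ∷_) (cube n) ++ map (inside ∷_) (cube n)

slices : ∀ {n k} → (Fin k → ℤ) → List (Subset n)
slices {n} r = filter (λ A → any? (λ i → (+ ∣ A ∣) ℤ.≟ r i)) (cube n)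

module _ (F : CompleteOrderedField) where
  open CompleteOrderedField F

  Lipschitz : ∀ {n} → (Subset n → ℝ) → Set
  Lipschitz X = ∀ A B → abs (X A - X B) ≤ fromℕ (hamming A B)

  -- Expectation and probability for the uniform distribution on a finite set,
  -- given as a list without repetitions.

  𝔼 : {S : Set} → List S → (S → ℝ) → ℝ
  𝔼 Ω X = foldr _+_ 0# (map X Ω) / fromℕ (length Ω)

  ℙ : {S : Set} (Ω : List S) {P : Pred S 0ℓ} → Decidable P → ℝ
  ℙ Ω P? = fromℕ (length (filter P? Ω)) / fromℕ (length Ω)

{-# OPTIONS --safe #-}
-- Compare the uniform law on the slices with the uniform law on the whole cube.
-- Induction on the coordinates and cosh u ≤ exp u² bound the moment generating
-- function of X − 𝔼 X over the cube, and Markov's inequality then shows that at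
-- most 2ⁿ exp (− h²/n) ≤ 2ⁿ exp (− h²/(2 (n − 1))) points satisfy X − 𝔼 X ≥ h.
-- It remains to see that every level C(n, s) with |n/2 − s| ≤ R exceeds
-- 2ⁿ/c^(R+3).  Moving away from the middle level, each step divides C(n, i) by at
-- most c, and the first ⌊R/2⌋ steps by at most √c only.  The R/4 powers of c saved
-- in this way, together with c³, pay for the middle level itself, which is at
-- least 2ⁿ/√(2 (n + 1)), since n ≤ c R² by ln (c/(c − 1)) ≥ 1/c.
module Submission where

open import Defs
open import Data.Fin using (Fin)
open import Data.Fin.Subset using (Subset)
open import Data.Integer using (ℤ)
open import Data.Nat as ℕ using (ℕ)
open import Data.Product using (_×_)
open import Function.Definitions using (Injective)
open import Relation.Binary.PropositionalEquality using (_≡_)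

import Algebra.Construct.NaturalChoice.Max as Max
import Algebra.Properties.CommutativeSemiring.Exp as CommutativeSemiringExp
import Algebra.Properties.Ring as RingProperties
import Algebra.Properties.Semiring.Exp as SemiringExp
import Algebra.Properties.Semiring.Mult as SemiringMult
import Algebra.Solver.Ring as RingSolver
open import Algebra.Solver.Ring.AlmostCommutativeRing
  using (fromCommutativeRing; _-Raw-AlmostCommutative⟶_; Induced-equivalence)
import Data.Fin as Fin
open import Data.Fin.Properties using (any?)
import Data.Fin.Properties as Fin
open import Data.Fin.Subset using (inside; outside; ∣_∣)
open import Data.Integer as ℤ using (+_; -[1+_])
import Data.Integer.Properties as ℤ
open import Data.List using (List; []; _∷_; _++_; map; filter; foldr; length)
open import Data.List.Properties using (length-++; length-map; filter-++)
open import Data.Maybe using (just; nothing)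
open import Data.Nat using (zero; suc)
open import Data.Nat.Combinatorics
  using (_C_; nCn≡1; nC1≡n; nCk≡nC[n∸k]; k>n⇒nCk≡0; nCk+nC[k+1]≡[n+1]C[k+1])
import Data.Nat.Properties as ℕ
open import Data.Nat.Tactic.RingSolver using (solve-∀)
open import Data.Product using (_,_; proj₁; proj₂; ∃-syntax)
open import Data.Sum using (inj₁; inj₂)
open import Data.Vec using ([]; _∷_)
open import Function using (_∘_)
open import Level using (0ℓ)
open import Relation.Binary.Bundles using (DecTotalOrder)
import Relation.Binary.Construct.NonStrictToStrict as ToStrict
open import Relation.Binary.Definitions using (WeaklyDecidable)
import Relation.Binary.PropositionalEquality as ≡
import Relation.Binary.Reasoning.PartialOrder as PartialOrderReasoning
import Relation.Binary.Reasoning.Setoid as SetoidReasoning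
open import Relation.Binary.Structures using (IsDecTotalOrder)
open import Relation.Nullary using (¬_; yes; no; contradiction)
open import Relation.Unary using (Pred; Decidable)

-- A level may lie R steps away from the middle, so a factor c per step already spends all of c^R.
-- Only c³ would then be left against √(2 (n + 1)), which is unbounded; this forces the finer
-- estimate of the steps next to the middle. As √c and √(2 (n + 1)) both occur, the levels are
-- compared through their squares, and c³ appears there as c⁶. Strictness of the final inequality
-- comes from the levels alone; the count of large deviations is bounded weakly.
--
-- The sharp bound cosh u ≤ exp (u²/2) would give the exponent 2h²/n. Losing the factor two is
-- affordable, and it makes the cosh bound accessible to elementary means.
--
-- The exponential is known only as a limit of compound powers, so its functional equation has to be
-- derived from them. Since ≤ is decidable, every inequality may be proved by contradiction, which
-- replaces natural numbers and limits that cannot be computed.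

module Binomials where

  open import Data.Nat
  open import Data.Nat.Properties
  open import Relation.Binary.PropositionalEquality

  -- Binomial coefficients: recurrences and the size of the middle one

  nC0≡1 : ∀ n → n C 0 ≡ 1
  nC0≡1 n = trans (nCk≡nC[n∸k] {0} {n} z≤n) (nCn≡1 n)

  absorption : ∀ n k → suc k * (suc n C suc k) ≡ suc n * (n C k)
  absorption zero    zero    = refl
  absorption zero    (suc k) = trans (cong (suc (suc k) *_) (k>n⇒nCk≡0 {1} {suc (suc k)} (s≤s (s≤s z≤n))))
    (trans (*-zeroʳ (suc (suc k))) (sym (cong (1 *_) (k>n⇒nCk≡0 {0} {suc k} (s≤s z≤n)))))
  absorption (suc n) zero    = begin
    1 * (suc (suc n) C 1)   ≡⟨ *-identityˡ _ ⟩
    suc (suc n) C 1         ≡⟨ nC1≡n (suc (suc n)) ⟩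
    suc (suc n)             ≡⟨ *-identityʳ _ ⟨
    suc (suc n) * 1         ≡⟨ cong (suc (suc n) *_) (nC0≡1 (suc n)) ⟨
    suc (suc n) * (suc n C 0) ∎
    where open ≡-Reasoning
  absorption (suc n) (suc k) = begin
    suc (suc k) * (suc (suc n) C suc (suc k))   ≡⟨ cong (suc (suc k) *_) (nCk+nC[k+1]≡[n+1]C[k+1] (suc n) (suc k)) ⟨
    suc (suc k) * (a + (suc n C suc (suc k)))   ≡⟨ split k a (suc n C suc (suc k)) ⟩
    a + (suc k * a + suc (suc k) * (suc n C suc (suc k)))
      ≡⟨ cong (λ z → a + z) (cong₂ _+_ (absorption n k) (absorption n (suc k))) ⟩
    a + (suc n * (n C k) + suc n * (n C suc k)) ≡⟨ cong (λ z → a + z) (*-distribˡ-+ (suc n) (n C k) (n C suc k)) ⟨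
    a + suc n * ((n C k) + (n C suc k))         ≡⟨ cong (λ z → a + suc n * z) (nCk+nC[k+1]≡[n+1]C[k+1] n k) ⟩
    suc (suc n) * a                             ∎
    where
    open ≡-Reasoning
    a = suc n C suc k
    split : ∀ k a b → suc (suc k) * (a + b) ≡ a + (suc k * a + suc (suc k) * b)
    split = solve-∀

  -- (i + 1) C(n, i + 1) = (n − i) C(n, i), moved around so that no subtraction occurs.
  C-ratio : ∀ n i → suc i * (n C suc i) + suc i * (n C i) ≡ suc n * (n C i)
  C-ratio n i = begin
    suc i * (n C suc i) + suc i * (n C i)   ≡⟨ +-comm (suc i * (n C suc i)) _ ⟩
    suc i * (n C i) + suc i * (n C suc i)   ≡⟨ *-distribˡ-+ (suc i) (n C i) (n C suc i) ⟨
    suc i * ((n C i) + (n C suc i))         ≡⟨ cong (suc i *_) (nCk+nC[k+1]≡[n+1]C[k+1] n i) ⟩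
    suc i * (suc n C suc i)                 ≡⟨ absorption n i ⟩
    suc n * (n C i)                         ∎
    where open ≡-Reasoning

  C-odd : ∀ m → suc m * (suc (m + m) C m) ≡ suc (m + m) * ((m + m) C m)
  C-odd m = trans (cong (suc m *_) sym-C) (absorption (m + m) m)
    where
    sym-C : suc (m + m) C m ≡ suc (m + m) C suc m
    sym-C = trans (nCk≡nC[n∸k] {m} {suc (m + m)} (m≤n⇒m≤1+n (m≤m+n m m)))
      (cong (suc (m + m) C_) (m+n∸n≡m (suc m) m))

  C-even : ∀ m → (suc m + suc m) C suc m ≡ 2 * (suc (m + m) C m)
  C-even m = *-cancelˡ-≡ _ _ (suc m) (begin
    suc m * ((suc m + suc m) C suc m)  ≡⟨ cong (λ k → suc m * (suc k C suc m)) (+-suc m m) ⟩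
    suc m * (suc (suc (m + m)) C suc m) ≡⟨ absorption (suc (m + m)) m ⟩
    suc (suc (m + m)) * b              ≡⟨ regroup m b ⟩
    suc m * (2 * b)                    ∎)
    where
    open ≡-Reasoning
    b = suc (m + m) C m
    regroup : ∀ m b → suc (suc (m + m)) * b ≡ suc m * (2 * b)
    regroup = solve-∀

  -- From m to m + 1 the central coefficient grows by the factor 2 (2m + 1)/(m + 1), and (2m + 1)² ≥
  -- 4m (m + 1) pays for the change of the linear factor. The induction starts at 1, with equality,
  -- because the bound fails at 0.
  central-bound : ∀ m → 16 ^ suc m ≤ 4 * suc m * (((suc m + suc m) C suc m) * ((suc m + suc m) C suc m))
  central-bound zero    = ≤-refl
  central-bound (suc m′) = *-cancelˡ-≤ (suc m) (begin
    suc m * 16 ^ suc m               ≡⟨ regroup₁ m (16 ^ m) ⟩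
    16 * suc m * 16 ^ m              ≤⟨ *-monoʳ-≤ (16 * suc m) (central-bound m′) ⟩
    16 * suc m * (4 * m * (a * a))   ≤⟨ ≤-trans (m≤m+n _ (16 * (a * a))) (≤-reflexive (regroup₂ m a)) ⟩
    16 * ((suc (m + m) * a) * (suc (m + m) * a)) ≡⟨ cong (λ z → 16 * (z * z)) (C-odd m) ⟨
    16 * ((suc m * b) * (suc m * b)) ≡⟨ regroup₃ m b ⟩
    suc m * (4 * suc m * ((2 * b) * (2 * b)))
      ≡⟨ cong (λ z → suc m * (4 * suc m * (z * z))) (C-even m) ⟨
    suc m * (4 * suc m * (a′ * a′))  ∎)
    where
    open ≤-Reasoning
    m = suc m′
    a = (m + m) C m
    b = suc (m + m) C m
    a′ = (suc m + suc m) C suc m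
    regroup₁ : ∀ m x → suc m * (16 * x) ≡ 16 * suc m * x
    regroup₁ = solve-∀
    regroup₂ : ∀ m a → 16 * suc m * (4 * m * (a * a)) + 16 * (a * a) ≡
      16 * ((suc (m + m) * a) * (suc (m + m) * a))
    regroup₂ = solve-∀
    regroup₃ : ∀ m b → 16 * ((suc m * b) * (suc m * b)) ≡ suc m * (4 * suc m * ((2 * b) * (2 * b)))
    regroup₃ = solve-∀

  data HalfOf (h : ℕ) : ℕ → Set where
    even : HalfOf h (h + h)
    odd  : HalfOf h (suc (h + h))

  half : ∀ n → ∃[ h ] HalfOf h n
  half zero = 0 , even
  half (suc n) with half n
  ... | h , even = h , odd
  ... | h , odd  = suc h , subst (HalfOf (suc h)) (cong suc (+-suc h h)) even

  4^[m+m]≡16^m : ∀ m → 4 ^ (m + m) ≡ 16 ^ m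
  4^[m+m]≡16^m m = trans (cong (λ k → 4 ^ (m + k)) (sym (+-identityʳ m))) (sym (^-*-assoc 4 2 m))

  -- Odd n = 2m + 1 dictates the factor 2 (n + 1): there C(n, m) is half of C(2m + 2, m + 1), and
  -- `central-bound` transfers without loss. For even n the factor 2n is weakened to it.
  middle-bound : ∀ {h n} → HalfOf h n → 4 ^ n ≤ 2 * suc n * ((n C h) * (n C h))
  middle-bound {zero}  even = s≤s z≤n
  middle-bound {suc m} even = begin
    4 ^ (suc m + suc m)         ≡⟨ 4^[m+m]≡16^m (suc m) ⟩
    16 ^ suc m                  ≤⟨ central-bound m ⟩
    4 * suc m * (a * a)         ≤⟨ ≤-trans (m≤m+n _ (2 * (a * a))) (≤-reflexive (regroup m (a * a))) ⟩
    2 * suc (suc m + suc m) * (a * a) ∎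
    where
    open ≤-Reasoning
    a = (suc m + suc m) C suc m
    regroup : ∀ m x → 4 * suc m * x + 2 * x ≡ 2 * suc (suc m + suc m) * x
    regroup = solve-∀
  middle-bound {m} odd = *-cancelˡ-≤ 4 (begin
    4 * 4 ^ suc (m + m)         ≡⟨ regroup₁ (4 ^ (m + m)) ⟩
    16 * 4 ^ (m + m)            ≡⟨ cong (16 *_) (4^[m+m]≡16^m m) ⟩
    16 ^ suc m                  ≤⟨ central-bound m ⟩
    4 * suc m * (a * a)         ≡⟨ cong (λ z → 4 * suc m * (z * z)) (C-even m) ⟩
    4 * suc m * ((2 * b) * (2 * b)) ≡⟨ regroup₂ m b ⟩
    4 * (2 * suc (suc (m + m)) * (b * b)) ∎)
    where
    open ≤-Reasoning
    a = (suc m + suc m) C suc m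
    b = suc (m + m) C m
    regroup₁ : ∀ x → 4 * (4 * x) ≡ 16 * x
    regroup₁ = solve-∀
    regroup₂ : ∀ m b → 4 * suc m * ((2 * b) * (2 * b)) ≡ 4 * (2 * suc (suc (m + m)) * (b * b))
    regroup₂ = solve-∀

  -- Only (K + 1)² + 1 ≤ 4 · 2ᴷ is needed, but that is not inductive.
  quadratic-≤-4*2^ : ∀ K → K * K + 3 * K + 4 ≤ 4 * 2 ^ K
  quadratic-≤-4*2^ zero    = ≤-refl
  quadratic-≤-4*2^ (suc K) = begin
    suc K * suc K + 3 * suc K + 4   ≤⟨ ≤-trans (m≤m+n _ (K * K + K)) (≤-reflexive (regroup₁ K)) ⟩
    2 * (K * K + 3 * K + 4)         ≤⟨ *-monoʳ-≤ 2 (quadratic-≤-4*2^ K) ⟩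
    2 * (4 * 2 ^ K)                 ≡⟨ regroup₂ (2 ^ K) ⟩
    4 * 2 ^ suc K                   ∎
    where
    open ≤-Reasoning
    regroup₁ : ∀ K → suc K * suc K + 3 * suc K + 4 + (K * K + K) ≡ 2 * (K * K + 3 * K + 4)
    regroup₁ = solve-∀
    regroup₂ : ∀ x → 2 * (4 * x) ≡ 4 * (2 * x)
    regroup₂ = solve-∀

  8[1+K]²+1<2^[5+K] : ∀ K → 8 * (suc K * suc K) + 1 < 2 ^ (5 + K)
  8[1+K]²+1<2^[5+K] K = begin
    suc (8 * (suc K * suc K) + 1)      ≤⟨ ≤-trans (m≤m+n _ (8 * K + 22)) (≤-reflexive (regroup₁ K)) ⟩
    8 * (K * K + 3 * K + 4)            ≤⟨ *-monoʳ-≤ 8 (quadratic-≤-4*2^ K) ⟩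
    8 * (4 * 2 ^ K)                    ≡⟨ regroup₂ (2 ^ K) ⟩
    2 ^ (5 + K)                        ∎
    where
    open ≤-Reasoning
    regroup₁ : ∀ K → suc (8 * (suc K * suc K) + 1) + (8 * K + 22) ≡ 8 * (K * K + 3 * K + 4)
    regroup₁ = solve-∀
    regroup₂ : ∀ x → 8 * (4 * x) ≡ 2 * (2 * (2 * (2 * (2 * x))))
    regroup₂ = solve-∀

  -- Counting filtered lists and the levels of the cube

  module _ {S : Set} where

    length-filter-map : ∀ {T : Set} {P : Pred S 0ℓ} (P? : Decidable P) (g : T → S) xs →
      length (filter P? (map g xs)) ≡ length (filter (P? ∘ g) xs)
    length-filter-map P? g []       = refl
    length-filter-map P? g (x ∷ xs) with P? (g x)
    ... | yes _ = cong suc (length-filter-map P? g xs)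
    ... | no  _ = length-filter-map P? g xs

    length-filter-none : ∀ {P : Pred S 0ℓ} (P? : Decidable P) xs → (∀ x → ¬ P x) → length (filter P? xs) ≡ 0
    length-filter-none P? []       ¬P = refl
    length-filter-none P? (x ∷ xs) ¬P with P? x
    ... | yes Px = contradiction Px (¬P x)
    ... | no  _  = length-filter-none P? xs ¬P

    length-filter-disjoint : ∀ {P Q U : Pred S 0ℓ} (P? : Decidable P) (Q? : Decidable Q) (U? : Decidable U) xs →
      (∀ x → P x → U x) → (∀ x → Q x → U x) → (∀ x → P x → ¬ Q x) →
      length (filter P? xs) + length (filter Q? xs) ≤ length (filter U? xs)
    length-filter-disjoint P? Q? U? []       P⊆U Q⊆U P∩Q≡∅ = z≤n
    length-filter-disjoint P? Q? U? (x ∷ xs) P⊆U Q⊆U P∩Q≡∅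
      with P? x | Q? x | U? x | length-filter-disjoint P? Q? U? xs P⊆U Q⊆U P∩Q≡∅
    ... | yes Px | yes Qx | _      | _  = contradiction Qx (P∩Q≡∅ x Px)
    ... | yes Px | no  _  | no ¬Ux | _  = contradiction (P⊆U x Px) ¬Ux
    ... | no  _  | yes Qx | no ¬Ux | _  = contradiction (Q⊆U x Qx) ¬Ux
    ... | yes _  | no  _  | yes _  | ih = s≤s ih
    ... | no  _  | yes _  | yes _  | ih = ≤-trans (≤-reflexive (+-suc _ _)) (s≤s ih)
    ... | no  _  | no  _  | yes _  | ih = m≤n⇒m≤1+n ih
    ... | no  _  | no  _  | no  _  | ih = ih

  length-level : ∀ n s {P : Pred (Subset n) 0ℓ} (P? : Decidable P) →
    (∀ A → P A → ∣ A ∣ ≡ s) → (∀ A → ∣ A ∣ ≡ s → P A) → length (filter P? (cube n)) ≡ n C s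
  length-level zero zero P? P⇒ P⇐ with P? []
  ... | yes _  = refl
  ... | no ¬P = contradiction (P⇐ [] refl) ¬P
  length-level zero (suc s) P? P⇒ P⇐ with P? []
  ... | yes P[] = contradiction (P⇒ [] P[]) λ ()
  ... | no  _   = sym (k>n⇒nCk≡0 {0} {suc s} (s≤s z≤n))
  length-level (suc n) s P? P⇒ P⇐ = begin
    length (filter P? (cube (suc n)))
      ≡⟨ cong length (filter-++ P? (map (outside ∷_) (cube n)) _) ⟩
    length (filter P? (map (outside ∷_) (cube n)) ++ filter P? (map (inside ∷_) (cube n)))
      ≡⟨ length-++ (filter P? (map (outside ∷_) (cube n))) ⟩
    length (filter P? (map (outside ∷_) (cube n))) + length (filter P? (map (inside ∷_) (cube n)))
      ≡⟨ cong₂ _+_ (trans (length-filter-map P? (outside ∷_) (cube n))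
                    (length-level n s (P? ∘ (outside ∷_)) (λ A → P⇒ (outside ∷ A)) (λ A → P⇐ (outside ∷ A))))
                  (length-filter-map P? (inside ∷_) (cube n)) ⟩
    (n C s) + length (filter (P? ∘ (inside ∷_)) (cube n))
      ≡⟨ with-inside s P? P⇒ P⇐ ⟩
    suc n C s ∎
    where
    open ≡-Reasoning
    with-inside : ∀ s {P : Pred (Subset (suc n)) 0ℓ} (P? : Decidable P) →
      (∀ A → P A → ∣ A ∣ ≡ s) → (∀ A → ∣ A ∣ ≡ s → P A) →
      (n C s) + length (filter (P? ∘ (inside ∷_)) (cube n)) ≡ suc n C s
    with-inside zero P? P⇒ P⇐ = trans
      (cong (λ z → (n C 0) + z) (length-filter-none (P? ∘ (inside ∷_)) (cube n)
        λ A PA → contradiction (P⇒ (inside ∷ A) PA) λ ()))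
      (trans (+-identityʳ _) (trans (nC0≡1 n) (sym (nC0≡1 (suc n)))))
    with-inside (suc s) P? P⇒ P⇐ = trans
      (cong (λ z → (n C suc s) + z) (length-level n s (P? ∘ (inside ∷_))
        (λ A PA → suc-injective (P⇒ (inside ∷ A) PA)) (λ A ∣A∣≡s → P⇐ (inside ∷ A) (cong suc ∣A∣≡s))))
      (trans (+-comm (n C suc s) (n C s)) (nCk+nC[k+1]≡[n+1]C[k+1] n s))

-- Ordered field arithmetic and a ring solver with integer coefficients

module OrderedField (F : CompleteOrderedField) where

  open CompleteOrderedField F
  open RingProperties ring
    using (-0#≈0#; -‿involutive; -‿distribˡ-*; -‿distribʳ-*; -‿+-comm)
  open SemiringMult semiring using (×-homo-+; ×1-homo-*)

  fromℕ-+ : ∀ m n → fromℕ (m ℕ.+ n) ≈ fromℕ m + fromℕ n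
  fromℕ-+ = ×-homo-+ 1#

  fromℕ-* : ∀ m n → fromℕ (m ℕ.* n) ≈ fromℕ m * fromℕ n
  fromℕ-* = ×1-homo-*

  fromℤ-neg : ∀ i → fromℤ (ℤ.- i) ≈ - fromℤ i
  fromℤ-neg (+ zero)  = sym -0#≈0#
  fromℤ-neg (+ suc n) = refl
  fromℤ-neg -[1+ n ]  = sym (-‿involutive _)

  fromℤ-⊖ : ∀ m n → fromℤ (m ℤ.⊖ n) ≈ fromℕ m - fromℕ n
  fromℤ-⊖ zero    zero    = sym (-‿inverseʳ 0#)
  fromℤ-⊖ zero    (suc n) = sym (+-identityˡ _)
  fromℤ-⊖ (suc m) zero    = sym (trans (+-congˡ -0#≈0#) (+-identityʳ _))
  fromℤ-⊖ (suc m) (suc n) = begin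
    fromℤ (suc m ℤ.⊖ suc n)                     ≡⟨ ≡.cong fromℤ (ℤ.[1+m]⊖[1+n]≡m⊖n m n) ⟩
    fromℤ (m ℤ.⊖ n)                             ≈⟨ fromℤ-⊖ m n ⟩
    fromℕ m - fromℕ n                           ≈⟨ +-congʳ (+-identityʳ _) ⟨
    (fromℕ m + 0#) - fromℕ n                    ≈⟨ +-congʳ (+-congˡ (-‿inverseʳ 1#)) ⟨
    (fromℕ m + (1# - 1#)) - fromℕ n             ≈⟨ +-congʳ (sym (+-assoc _ _ _)) ⟩
    ((fromℕ m + 1#) - 1#) - fromℕ n             ≈⟨ +-assoc _ _ _ ⟩
    (fromℕ m + 1#) + (- 1# - fromℕ n)           ≈⟨ +-cong (+-comm _ _) (-‿+-comm _ _) ⟩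
    (1# + fromℕ m) - (1# + fromℕ n)             ∎
    where open SetoidReasoning setoid

  fromℤ-+ : ∀ i j → fromℤ (i ℤ.+ j) ≈ fromℤ i + fromℤ j
  fromℤ-+ (+ m)    (+ n)    = fromℕ-+ m n
  fromℤ-+ (+ m)    -[1+ n ] = fromℤ-⊖ m (suc n)
  fromℤ-+ -[1+ m ] (+ n)    = trans (fromℤ-⊖ n (suc m)) (+-comm _ _)
  fromℤ-+ -[1+ m ] -[1+ n ] = begin
    - fromℕ (suc (suc (m ℕ.+ n)))     ≡⟨ ≡.cong (λ k → - fromℕ (suc k)) (≡.sym (ℕ.+-suc m n)) ⟩
    - fromℕ (suc m ℕ.+ suc n)         ≈⟨ -‿cong (fromℕ-+ (suc m) (suc n)) ⟩
    - (fromℕ (suc m) + fromℕ (suc n)) ≈⟨ -‿+-comm _ _ ⟨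
    - fromℕ (suc m) - fromℕ (suc n)   ∎
    where open SetoidReasoning setoid

  fromℤ-*-+ : ∀ m j → fromℤ (+ m ℤ.* j) ≈ fromℕ m * fromℤ j
  fromℤ-*-+ m (+ n) = begin
    fromℤ (+ m ℤ.* + n)  ≡⟨ ≡.cong fromℤ (≡.sym (ℤ.pos-* m n)) ⟩
    fromℕ (m ℕ.* n)      ≈⟨ fromℕ-* m n ⟩
    fromℕ m * fromℕ n    ∎
    where open SetoidReasoning setoid
  fromℤ-*-+ m -[1+ n ] = begin
    fromℤ (+ m ℤ.* ℤ.- (+ suc n))   ≡⟨ ≡.cong fromℤ (≡.sym (ℤ.neg-distribʳ-* (+ m) (+ suc n))) ⟩
    fromℤ (ℤ.- (+ m ℤ.* + suc n))   ≈⟨ fromℤ-neg (+ m ℤ.* + suc n) ⟩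
    - fromℤ (+ m ℤ.* + suc n)       ≈⟨ -‿cong (fromℤ-*-+ m (+ suc n)) ⟩
    - (fromℕ m * fromℕ (suc n))     ≈⟨ -‿distribʳ-* _ _ ⟩
    fromℕ m * - fromℕ (suc n)       ∎
    where open SetoidReasoning setoid

  fromℤ-* : ∀ i j → fromℤ (i ℤ.* j) ≈ fromℤ i * fromℤ j
  fromℤ-* (+ m)    j = fromℤ-*-+ m j
  fromℤ-* -[1+ m ] j = begin
    fromℤ (ℤ.- (+ suc m) ℤ.* j)     ≡⟨ ≡.cong fromℤ (≡.sym (ℤ.neg-distribˡ-* (+ suc m) j)) ⟩
    fromℤ (ℤ.- (+ suc m ℤ.* j))     ≈⟨ fromℤ-neg (+ suc m ℤ.* j) ⟩
    - fromℤ (+ suc m ℤ.* j)         ≈⟨ -‿cong (fromℤ-*-+ (suc m) j) ⟩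
    - (fromℕ (suc m) * fromℤ j)     ≈⟨ -‿distribˡ-* _ _ ⟩
    - fromℕ (suc m) * fromℤ j       ∎
    where open SetoidReasoning setoid

  -- Agrees with fromℤ, except that con (+ 1) denotes 1# itself and not 1# + 0#.
  ⟦_⟧ℤ : ℤ → ℝ
  ⟦ + 1 ⟧ℤ = 1#
  ⟦ i   ⟧ℤ = fromℤ i

  ⟦⟧ℤ≈fromℤ : ∀ i → ⟦ i ⟧ℤ ≈ fromℤ i
  ⟦⟧ℤ≈fromℤ (+ 0)           = refl
  ⟦⟧ℤ≈fromℤ (+ 1)           = sym (+-identityʳ 1#)
  ⟦⟧ℤ≈fromℤ (+ suc (suc n)) = refl
  ⟦⟧ℤ≈fromℤ -[1+ n ]        = refl

  ℤ-morphism : ℤ.+-*-rawRing -Raw-AlmostCommutative⟶ fromCommutativeRing commutativeRing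
  ℤ-morphism = record
    { ⟦_⟧    = ⟦_⟧ℤ
    ; +-homo = λ i j → trans (⟦⟧ℤ≈fromℤ (i ℤ.+ j)) (trans (fromℤ-+ i j)
                         (sym (+-cong (⟦⟧ℤ≈fromℤ i) (⟦⟧ℤ≈fromℤ j))))
    ; *-homo = λ i j → trans (⟦⟧ℤ≈fromℤ (i ℤ.* j)) (trans (fromℤ-* i j)
                         (sym (*-cong (⟦⟧ℤ≈fromℤ i) (⟦⟧ℤ≈fromℤ j))))
    ; -‿homo = λ i → trans (⟦⟧ℤ≈fromℤ (ℤ.- i)) (trans (fromℤ-neg i)
                       (sym (-‿cong (⟦⟧ℤ≈fromℤ i))))
    ; 0-homo = refl
    ; 1-homo = refl
    }

  _coeff≟_ : WeaklyDecidable (Induced-equivalence ℤ-morphism)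
  i coeff≟ j with i ℤ.≟ j
  ... | yes i≡j = just (reflexive (≡.cong ⟦_⟧ℤ i≡j))
  ... | no  _   = nothing

  open RingSolver ℤ.+-*-rawRing (fromCommutativeRing commutativeRing) ℤ-morphism _coeff≟_
    using (solve; _:=_; _:+_; _:*_; _:-_; :-_; con) public

  open IsDecTotalOrder isDecTotalOrder public
    using () renaming (refl to ≤-refl; reflexive to ≤-reflexive; trans to ≤-trans;
                       antisym to ≤-antisym; total to ≤-total;
                       ≤-respˡ-≈ to ≤-respˡ; ≤-respʳ-≈ to ≤-respʳ)

  module ≤-R = PartialOrderReasoning (DecTotalOrder.poset decTotalOrder)

  ≰⇒> : ∀ {x y} → ¬ (x ≤ y) → y < x
  ≰⇒> = ToStrict.≰⇒> _≈_ _≤_ sym ≤-reflexive ≤-total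

  <⇒≱ : ∀ {x y} → x < y → ¬ (y ≤ x)
  <⇒≱ = ToStrict.<⇒≱ _≈_ _≤_ ≤-antisym

  <-≤-trans : ∀ {x y z} → x < y → y ≤ z → x < z
  <-≤-trans = ToStrict.<-≤-trans _≈_ _≤_ sym ≤-trans ≤-antisym ≤-respʳ

  ≤-<-trans : ∀ {x y z} → x ≤ y → y < z → x < z
  ≤-<-trans = ToStrict.≤-<-trans _≈_ _≤_ ≤-trans ≤-antisym ≤-respˡ

  ≤-stable : ∀ {x y} → ¬ (y < x) → x ≤ y
  ≤-stable {x} {y} ¬y<x with x ≤? y
  ... | yes x≤y = x≤y
  ... | no  x≰y = contradiction (≰⇒> x≰y) ¬y<x

  -- The pattern of most inequalities below: d is a certificate, visibly nonnegative as a
  -- combination of hypotheses and squares, and the remaining polynomial identity goes to the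
  -- solver.
  ≤-by : ∀ {x y d} → 0# ≤ d → y ≈ x + d → x ≤ y
  ≤-by {x} {y} {d} 0≤d y≈x+d = begin
    x       ≈⟨ +-identityˡ x ⟨
    0# + x  ≤⟨ +-mono-≤ x 0≤d ⟩
    d + x   ≈⟨ +-comm d x ⟩
    x + d   ≈⟨ y≈x+d ⟨
    y       ∎
    where open ≤-R

  diff-nonneg : ∀ {x y} → x ≤ y → 0# ≤ y - x
  diff-nonneg {x} {y} x≤y = ≤-respˡ (-‿inverseʳ x) (+-mono-≤ (- x) x≤y)

  +-mono₂-≤ : ∀ {x y u v} → x ≤ y → u ≤ v → x + u ≤ y + v
  +-mono₂-≤ {x} {y} {u} {v} x≤y u≤v = begin
    x + u  ≤⟨ +-mono-≤ u x≤y ⟩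
    y + u  ≈⟨ +-comm y u ⟩
    u + y  ≤⟨ +-mono-≤ y u≤v ⟩
    v + y  ≈⟨ +-comm v y ⟩
    y + v  ∎
    where open ≤-R

  +-nonneg : ∀ {x y} → 0# ≤ x → 0# ≤ y → 0# ≤ x + y
  +-nonneg 0≤x 0≤y = ≤-respˡ (+-identityˡ 0#) (+-mono₂-≤ 0≤x 0≤y)

  *-monoˡ-≤ : ∀ {x y} z → 0# ≤ z → x ≤ y → z * x ≤ z * y
  *-monoˡ-≤ {x} {y} z 0≤z x≤y = ≤-by (*-nonneg 0≤z (diff-nonneg x≤y))
    (solve 3 (λ x y z → z :* y := z :* x :+ z :* (y :- x)) refl x y z)

  *-monoʳ-≤ : ∀ {x y} z → 0# ≤ z → x ≤ y → x * z ≤ y * z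
  *-monoʳ-≤ z 0≤z x≤y =
    ≤-respˡ (*-comm z _) (≤-respʳ (*-comm z _) (*-monoˡ-≤ z 0≤z x≤y))

  *-mono₂-≤ : ∀ {x y u v} → 0# ≤ x → x ≤ y → 0# ≤ u → u ≤ v → x * u ≤ y * v
  *-mono₂-≤ 0≤x x≤y 0≤u u≤v =
    ≤-trans (*-monoʳ-≤ _ 0≤u x≤y) (*-monoˡ-≤ _ (≤-trans 0≤x x≤y) u≤v)

  square-nonneg : ∀ x → 0# ≤ x * x
  square-nonneg x with ≤-total 0# x
  ... | inj₁ 0≤x = *-nonneg 0≤x 0≤x
  ... | inj₂ x≤0 = ≤-respʳ (solve 1 (λ x → (con (+ 0) :- x) :* (con (+ 0) :- x) := x :* x) refl x)
                     (*-nonneg (diff-nonneg x≤0) (diff-nonneg x≤0))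

  0≤1 : 0# ≤ 1#
  0≤1 = ≤-respʳ (*-identityˡ 1#) (square-nonneg 1#)

  0<1 : 0# < 1#
  0<1 = 0≤1 , 0≉1

  fromℕ-nonneg : ∀ n → 0# ≤ fromℕ n
  fromℕ-nonneg zero    = ≤-refl
  fromℕ-nonneg (suc n) = +-nonneg 0≤1 (fromℕ-nonneg n)

  fromℕ-mono-≤ : ∀ {m n} → m ℕ.≤ n → fromℕ m ≤ fromℕ n
  fromℕ-mono-≤ {n = n} ℕ.z≤n = fromℕ-nonneg n
  fromℕ-mono-≤ (ℕ.s≤s m≤n) = +-mono₂-≤ ≤-refl (fromℕ-mono-≤ m≤n)

  fromℕ-1 : fromℕ 1 ≈ 1#
  fromℕ-1 = +-identityʳ 1#

  fromℕ-pos : ∀ {n} → 1 ℕ.≤ n → 0# < fromℕ n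
  fromℕ-pos 1≤n = <-≤-trans 0<1 (≤-respˡ fromℕ-1 (fromℕ-mono-≤ 1≤n))

  fromℕ-mono-< : ∀ {m n} → m ℕ.< n → fromℕ m < fromℕ n
  fromℕ-mono-< {m} {n} m<n = <-≤-trans
    (≤-by 0≤1 (+-comm 1# (fromℕ m)) , λ m≈1+m → 0≉1 (trans (sym (-‿inverseʳ (fromℕ m)))
      (trans (+-congʳ m≈1+m) (solve 1 (λ x → (con (+ 1) :+ x) :- x := con (+ 1)) refl (fromℕ m)))))
    (fromℕ-mono-≤ m<n)

  ⁻¹-inverseˡ : ∀ {x} → 0# < x → x ⁻¹ * x ≈ 1#
  ⁻¹-inverseˡ {x} (_ , 0≉x) = trans (*-comm _ _) (⁻¹-inverse x (0≉x ∘ sym))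

  ⁻¹-inverseʳ : ∀ {x} → 0# < x → x * x ⁻¹ ≈ 1#
  ⁻¹-inverseʳ {x} (_ , 0≉x) = ⁻¹-inverse x (0≉x ∘ sym)

  ⁻¹-nonneg : ∀ {x} → 0# < x → 0# ≤ x ⁻¹
  ⁻¹-nonneg {x} 0<x with ≤-total 0# (x ⁻¹)
  ... | inj₁ 0≤x⁻¹ = 0≤x⁻¹
  ... | inj₂ x⁻¹≤0 = contradiction
    (≤-respˡ (⁻¹-inverseʳ 0<x) (≤-respʳ (zeroʳ x) (*-monoˡ-≤ x (proj₁ 0<x) x⁻¹≤0)))
    (<⇒≱ 0<1)

  *-cancelˡ-≤ : ∀ {x y z} → 0# < z → z * x ≤ z * y → x ≤ y
  *-cancelˡ-≤ {x} {y} {z} 0<z zx≤zy = ≤-respˡ (unit x) (≤-respʳ (unit y)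
    (*-monoˡ-≤ (z ⁻¹) (⁻¹-nonneg 0<z) zx≤zy))
    where
    unit : ∀ w → z ⁻¹ * (z * w) ≈ w
    unit w = trans (sym (*-assoc _ _ _)) (trans (*-congʳ (⁻¹-inverseˡ 0<z)) (*-identityˡ w))

  *-cancelˡ-< : ∀ {x y z} → 0# ≤ z → z * x < z * y → x < y
  *-cancelˡ-< 0≤z zx<zy = ≰⇒> λ y≤x → <⇒≱ zx<zy (*-monoˡ-≤ _ 0≤z y≤x)

  *-monoˡ-< : ∀ {x y} z → 0# < z → x < y → z * x < z * y
  *-monoˡ-< z 0<z x<y = ≰⇒> λ zy≤zx → <⇒≱ x<y (*-cancelˡ-≤ 0<z zy≤zx)

  *-monoʳ-< : ∀ {x y} z → 0# < z → x < y → x * z < y * z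
  *-monoʳ-< {x} {y} z 0<z x<y = ≰⇒> λ yz≤xz → <⇒≱ x<y
    (*-cancelˡ-≤ 0<z (≤-respˡ (*-comm y z) (≤-respʳ (*-comm x z) yz≤xz)))

  *-pos : ∀ {x y} → 0# < x → 0# < y → 0# < x * y
  *-pos {x} 0<x 0<y = ≤-<-trans (≤-reflexive (sym (zeroʳ x))) (*-monoˡ-< x 0<x 0<y)

  square-cancel-≤ : ∀ {x y} → 0# ≤ y → x * x ≤ y * y → x ≤ y
  square-cancel-≤ 0≤y xx≤yy = ≤-stable λ y<x → <⇒≱
    (≤-<-trans (*-monoˡ-≤ _ 0≤y (proj₁ y<x)) (*-monoʳ-< _ (≤-<-trans 0≤y y<x) y<x)) xx≤yy

  square-mono-≤ : ∀ {x y} → 0# ≤ x → x ≤ y → x * x ≤ y * y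
  square-mono-≤ 0≤x x≤y = *-mono₂-≤ 0≤x x≤y 0≤x x≤y

  square-cancel-< : ∀ {x y} → 0# ≤ y → x * x < y * y → x < y
  square-cancel-< 0≤y xx<yy = ≰⇒> λ y≤x → <⇒≱ xx<yy (square-mono-≤ 0≤y y≤x)

  ^-nonneg : ∀ {x} n → 0# ≤ x → 0# ≤ x ^ n
  ^-nonneg zero    0≤x = 0≤1
  ^-nonneg (suc n) 0≤x = *-nonneg 0≤x (^-nonneg n 0≤x)

  ^-pos : ∀ {x} n → 0# < x → 0# < x ^ n
  ^-pos zero    0<x = 0<1
  ^-pos (suc n) 0<x = *-pos 0<x (^-pos n 0<x)

  ^-monoˡ-≤ : ∀ {x y} n → 0# ≤ x → x ≤ y → x ^ n ≤ y ^ n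
  ^-monoˡ-≤ zero    0≤x x≤y = ≤-refl
  ^-monoˡ-≤ (suc n) 0≤x x≤y = *-mono₂-≤ 0≤x x≤y (^-nonneg n 0≤x) (^-monoˡ-≤ n 0≤x x≤y)

  1≤^ : ∀ {x} n → 1# ≤ x → 1# ≤ x ^ n
  1≤^ zero    1≤x = ≤-refl
  1≤^ (suc n) 1≤x = ≤-respˡ (*-identityˡ 1#) (*-mono₂-≤ 0≤1 1≤x 0≤1 (1≤^ n 1≤x))

  bernoulli : ∀ {a} n → 0# ≤ 1# + a → 1# + fromℕ n * a ≤ (1# + a) ^ n
  bernoulli {a} zero    0≤1+a = ≤-reflexive
    (solve 1 (λ a → con (+ 1) :+ con (+ 0) :* a := con (+ 1)) refl a)
  bernoulli {a} (suc n) 0≤1+a = ≤-trans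
    (≤-by (*-nonneg (fromℕ-nonneg n) (square-nonneg a))
      (solve 2 (λ a n → (con (+ 1) :+ a) :* (con (+ 1) :+ n :* a) :=
        (con (+ 1) :+ (con (+ 1) :+ n) :* a) :+ n :* (a :* a)) refl a (fromℕ n)))
    (*-monoˡ-≤ _ 0≤1+a (bernoulli n 0≤1+a))

-- The exponential function and the cosh bound

module Exponential (F : CompleteOrderedField) (E : ExpLnSqrt F) where

  open OrderedField F

  open CompleteOrderedField F
  open ExpLnSqrt E
  open CommutativeSemiringExp commutativeSemiring using (^-distrib-*)
  open Max (DecTotalOrder.totalOrder decTotalOrder) using (x≤x⊔y; x≤y⊔x)

  -- For a supremum s of the natural numbers, n + 1 ≤ s for all n makes s - 1 an upper bound as
  -- well.
  archimedean : ∀ x → ¬ (∀ n → fromℕ n ≤ x)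
  archimedean x bound =
    let s , upper , least = supremum (λ y → ∃[ n ] y ≈ fromℕ n) (fromℕ 0 , 0 , refl)
                              (x , λ y (n , y≈n) → ≤-respˡ (sym y≈n) (bound n))
        s≤s-1 = least (s - 1#) λ y (n , y≈n) →
          ≤-by (diff-nonneg (upper (fromℕ (suc n)) (suc n , refl)))
            (trans (solve 2 (λ s n → s :- con (+ 1) := n :+ (s :- (con (+ 1) :+ n))) refl s (fromℕ n))
              (+-congʳ (sym y≈n)))
    in <⇒≱ 0<1 (≤-by (diff-nonneg s≤s-1)
         (solve 1 (λ s → con (+ 0) := con (+ 1) :+ ((s :- con (+ 1)) :- s)) refl s))

  -- A natural number above z cannot be exhibited constructively, but it may be assumed
  -- when proving an inequality, because ≤ is decidable.
  archimedean-≤ : ∀ z {x y} → (∀ n → z ≤ fromℕ n → x ≤ y) → x ≤ y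
  archimedean-≤ z {x} {y} x≤y = ≤-stable λ y<x → archimedean z λ n →
    ≤-stable λ z<n → <⇒≱ y<x (x≤y n (proj₁ z<n))

  -- The restriction to ε ≤ 1 allows errors of order ε², as they arise for products of limits, to be
  -- absorbed into ε s.
  ε-≤ : ∀ {x y} s → 0# ≤ s → (∀ ε → 0# < ε → ε ≤ 1# → x ≤ y + ε * s) → x ≤ y
  ε-≤ {x} {y} s 0≤s x≤y+εs = ≤-stable λ y<x →
    let d   = x - y
        0<d = diff-nonneg (proj₁ y<x) , λ 0≈d → proj₂ y<x
                (trans (sym (+-identityˡ y)) (trans (+-congʳ 0≈d)
                  (solve 2 (λ x y → (x :- y) :+ y := x) refl x y)))
        -- The tested value is ε = d/t. The summand d makes it at most 1; together with the summand
        -- 1 it also makes s/t smaller than 1, so that d ≤ ε s is impossible.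
        t   = s + (d + 1#)
        0<t = <-≤-trans 0<1 (≤-by (+-nonneg 0≤s (proj₁ 0<d))
                (solve 2 (λ s d → s :+ (d :+ con (+ 1)) := con (+ 1) :+ (s :+ d)) refl s d))
        w   = t ⁻¹
        0≤w = ⁻¹-nonneg 0<t
        wt  = ⁻¹-inverseˡ 0<t
        0<w = 0≤w , λ 0≈w → 0≉1 (trans (sym (zeroˡ t)) (trans (*-congʳ 0≈w) wt))
        dw≤1 = ≤-by (*-nonneg 0≤w (+-nonneg 0≤s 0≤1))
                 (trans (sym wt) (solve 3 (λ w s d → w :* (s :+ (d :+ con (+ 1))) :=
                   d :* w :+ w :* (s :+ con (+ 1))) refl w s d))
        d≤dws = ≤-by (diff-nonneg (x≤y+εs (d * w) (*-pos 0<d 0<w) dw≤1))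
                 (solve 4 (λ x y w s → (x :- y) :* (w :* s) :=
                   (x :- y) :* con (+ 1) :+ ((y :+ (x :- y) :* w :* s) :- x)) refl x y w s)
        1≤ws = *-cancelˡ-≤ 0<d d≤dws
    in <⇒≱ 0<w (≤-by (+-nonneg (diff-nonneg 1≤ws) (*-nonneg 0≤w (proj₁ 0<d)))
         (trans (solve 3 (λ w s d → con (+ 0) := w :+ ((w :* s :- con (+ 1)) :+ w :* d :+
                   (con (+ 1) :- w :* (s :+ (d :+ con (+ 1)))))) refl w s d)
           (+-congˡ (trans (+-congˡ (trans (+-congˡ (-‿cong wt)) (-‿inverseʳ 1#))) (+-identityʳ _)))))

  convergent-bounds : ∀ {u l} → ConvergesTo u l → ∀ ε → 0# < ε →
    ∃[ N ] ∀ m → N ℕ.≤ m → u m ≤ l + ε × l ≤ u m + ε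
  convergent-bounds {u} {l} u→l ε 0<ε =
    let N , close = u→l ε 0<ε
    in N , λ m N≤m →
      ≤-by (diff-nonneg (≤-trans (x≤x⊔y _ _) (proj₁ (close m N≤m))))
        (solve 3 (λ u l ε → l :+ ε := u :+ (ε :- (u :- l))) refl (u m) l ε) ,
      ≤-by (diff-nonneg (≤-trans (x≤y⊔x _ _) (proj₁ (close m N≤m))))
        (solve 3 (λ u l ε → u :+ ε := l :+ (ε :- (:- (u :- l)))) refl (u m) l ε)

  lim-lower : ∀ {u l a} N → ConvergesTo u l → (∀ m → N ℕ.≤ m → a ≤ u m) → a ≤ l
  lim-lower N u→l a≤u = ε-≤ 1# 0≤1 λ ε 0<ε _ →
    let M , close = convergent-bounds u→l ε 0<ε
        m = N ℕ.⊔ M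
    in ≤-trans (a≤u m (ℕ.m≤m⊔n N M))
         (≤-respʳ (+-congˡ (sym (*-identityʳ ε))) (proj₁ (close m (ℕ.m≤n⊔m N M))))

  lim-mono : ∀ {u v a b} N → ConvergesTo u a → ConvergesTo v b →
    (∀ m → N ℕ.≤ m → u m ≤ v m) → a ≤ b
  lim-mono {u} {v} {a} {b} N u→a v→b u≤v = ε-≤ (fromℕ 2) (fromℕ-nonneg 2) λ ε 0<ε _ →
    let M , closeᵤ = convergent-bounds u→a ε 0<ε
        L , closeᵥ = convergent-bounds v→b ε 0<ε
        m = N ℕ.⊔ (M ℕ.⊔ L)
        aᵤ = proj₂ (closeᵤ m (ℕ.m≤n⇒m≤o⊔n N (ℕ.m≤m⊔n M L)))
        bᵥ = proj₁ (closeᵥ m (ℕ.m≤n⇒m≤o⊔n N (ℕ.m≤n⊔m M L)))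
    in ≤-by (+-nonneg (+-nonneg (diff-nonneg aᵤ) (diff-nonneg bᵥ))
                      (diff-nonneg (u≤v m (ℕ.m≤m⊔n N _))))
         (solve 5 (λ a b u v ε → b :+ ε :* con (+ 2) :=
           a :+ (((u :+ ε) :- a) :+ ((b :+ ε) :- v) :+ (v :- u))) refl a b (u m) (v m) ε)

  lim-*-≤ : ∀ {u v w a b c} N → ConvergesTo u a → ConvergesTo v b → ConvergesTo w c →
    0# ≤ a → 0# ≤ b → (∀ m → N ℕ.≤ m → 0# ≤ u m × 0# ≤ v m × u m * v m ≤ w m) → a * b ≤ c
  lim-*-≤ {u} {v} {w} {a} {b} {c} N u→a v→b w→c 0≤a 0≤b uv≤w =
    -- Here a b ≤ (u + ε)(v + ε) ≤ w + ε (a + b) + 3ε² and w ≤ c + ε, whence 4 = 3 + 1.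
    ε-≤ (a + b + fromℕ 4) (+-nonneg (+-nonneg 0≤a 0≤b) (fromℕ-nonneg 4)) λ ε 0<ε ε≤1 →
    let M , closeᵤ = convergent-bounds u→a ε 0<ε
        L , closeᵥ = convergent-bounds v→b ε 0<ε
        K , closew = convergent-bounds w→c ε 0<ε
        m = N ℕ.⊔ (M ℕ.⊔ (L ℕ.⊔ K))
        N≤m = ℕ.m≤m⊔n N (M ℕ.⊔ (L ℕ.⊔ K))
        M≤m = ℕ.m≤n⇒m≤o⊔n N (ℕ.m≤m⊔n M (L ℕ.⊔ K))
        L≤m = ℕ.m≤n⇒m≤o⊔n N (ℕ.m≤n⇒m≤o⊔n M (ℕ.m≤m⊔n L K))
        K≤m = ℕ.m≤n⇒m≤o⊔n N (ℕ.m≤n⇒m≤o⊔n M (ℕ.m≤n⊔m L K))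
        0≤u , 0≤v , prod = uv≤w m N≤m
        u≤ , a≤ = closeᵤ m M≤m
        v≤ , b≤ = closeᵥ m L≤m
        w≤ , _  = closew m K≤m
        0≤ε = proj₁ 0<ε
    in ≤-by
         (+-nonneg (+-nonneg (+-nonneg (diff-nonneg (*-mono₂-≤ 0≤a a≤ 0≤b b≤)) (diff-nonneg prod))
                             (diff-nonneg w≤))
           (+-nonneg (*-nonneg 0≤ε (+-nonneg (diff-nonneg u≤) (diff-nonneg v≤)))
             (*-nonneg (fromℕ-nonneg 3) (*-nonneg 0≤ε (diff-nonneg ε≤1)))))
         (solve 7 (λ a b c u v w ε →
           c :+ ε :* (a :+ b :+ con (+ 4)) :=
           a :* b :+ (((u :+ ε) :* (v :+ ε) :- a :* b :+ (w :- u :* v) :+ ((c :+ ε) :- w)) :+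
             (ε :* (((a :+ ε) :- u) :+ ((b :+ ε) :- v)) :+ con (+ 3) :* (ε :* (con (+ 1) :- ε)))))
           refl a b c (u m) (v m) (w m) ε)

  lim-≤-* : ∀ {u v w a b c} N → ConvergesTo u a → ConvergesTo v b → ConvergesTo w c →
    0# ≤ a → 0# ≤ b → (∀ m → N ℕ.≤ m → 0# ≤ u m × 0# ≤ v m × w m ≤ u m * v m) → c ≤ a * b
  lim-≤-* {u} {v} {w} {a} {b} {c} N u→a v→b w→c 0≤a 0≤b w≤uv =
    ε-≤ (a + b + fromℕ 2) (+-nonneg (+-nonneg 0≤a 0≤b) (fromℕ-nonneg 2)) λ ε 0<ε ε≤1 →
    let M , closeᵤ = convergent-bounds u→a ε 0<ε
        L , closeᵥ = convergent-bounds v→b ε 0<ε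
        K , closew = convergent-bounds w→c ε 0<ε
        m = N ℕ.⊔ (M ℕ.⊔ (L ℕ.⊔ K))
        N≤m = ℕ.m≤m⊔n N (M ℕ.⊔ (L ℕ.⊔ K))
        M≤m = ℕ.m≤n⇒m≤o⊔n N (ℕ.m≤m⊔n M (L ℕ.⊔ K))
        L≤m = ℕ.m≤n⇒m≤o⊔n N (ℕ.m≤n⇒m≤o⊔n M (ℕ.m≤m⊔n L K))
        K≤m = ℕ.m≤n⇒m≤o⊔n N (ℕ.m≤n⇒m≤o⊔n M (ℕ.m≤n⊔m L K))
        0≤u , 0≤v , prod = w≤uv m N≤m
        u≤ , _ = closeᵤ m M≤m
        v≤ , _ = closeᵥ m L≤m
        _ , c≤ = closew m K≤m
        0≤ε = proj₁ 0<ε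
    in ≤-by
         (+-nonneg (+-nonneg (+-nonneg (diff-nonneg (*-mono₂-≤ 0≤u u≤ 0≤v v≤)) (diff-nonneg prod))
                             (diff-nonneg c≤))
           (*-nonneg 0≤ε (diff-nonneg ε≤1)))
         (solve 7 (λ a b c u v w ε →
           a :* b :+ ε :* (a :+ b :+ con (+ 2)) :=
           c :+ (((a :+ ε) :* (b :+ ε) :- u :* v :+ (u :* v :- w) :+ ((w :+ ε) :- c)) :+
             ε :* (con (+ 1) :- ε)))
           refl a b c (u m) (v m) (w m) ε)

  compound : ℝ → ℕ → ℝ
  compound x m = (1# + x / fromℕ (suc m)) ^ suc m

  module _ (m : ℕ) where
    private
      ν   = fromℕ (suc m)
      0<ν = fromℕ-pos {suc m} (ℕ.s≤s ℕ.z≤n)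
      w   = ν ⁻¹
      0≤w = ⁻¹-nonneg 0<ν
      wν  = ⁻¹-inverseʳ 0<ν

    compound-base-nonneg : ∀ {x} → - x ≤ ν → 0# ≤ 1# + x / ν
    compound-base-nonneg {x} -x≤ν = ≤-respʳ
      (trans (solve 3 (λ ν x w → (ν :- (:- x)) :* w := ν :* w :+ x :* w) refl ν x w) (+-congʳ wν))
      (*-nonneg (diff-nonneg -x≤ν) 0≤w)

    compound-nonneg : ∀ {x} → - x ≤ ν → 0# ≤ compound x m
    compound-nonneg -x≤ν = ^-nonneg (suc m) (compound-base-nonneg -x≤ν)

    compound-mono : ∀ {x y} → - x ≤ ν → x ≤ y → compound x m ≤ compound y m
    compound-mono -x≤ν x≤y = ^-monoˡ-≤ (suc m) (compound-base-nonneg -x≤ν)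
      (+-mono₂-≤ ≤-refl (*-monoʳ-≤ w 0≤w x≤y))

    1+x≤compound : ∀ {x} → - x ≤ ν → 1# + x ≤ compound x m
    1+x≤compound {x} -x≤ν = ≤-respˡ
      (+-congˡ (trans (solve 3 (λ ν x w → ν :* (x :* w) := x :* (ν :* w)) refl ν x w)
        (trans (*-congˡ wν) (*-identityʳ x))))
      (bernoulli (suc m) (compound-base-nonneg -x≤ν))

    private
      -- The product of the bases for x and y differs from the base for x + y + ε by (x y - ν ε)/ν².
      -- However small ε is, its sign decides the comparison as soon as ν is large; this is what
      -- squeezes exp x · exp y.
      base-* : ∀ x y ε → (1# + x / ν) * (1# + y / ν) ≈ (1# + (x + y + ε) / ν) + w * (w * (x * y - ν * ε))
      base-* x y ε = trans
        (solve 4 (λ x y ε w → (con (+ 1) :+ x :* w) :* (con (+ 1) :+ y :* w) :=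
           (con (+ 1) :+ (x :+ y :+ ε) :* w) :+ w :* (w :* (x :* y) :- con (+ 1) :* ε)) refl x y ε w)
        (+-congˡ (*-congˡ (trans (+-congˡ (-‿cong (*-congʳ (sym wν))))
          (solve 5 (λ x y ε w ν → w :* (x :* y) :- (ν :* w) :* ε := w :* (x :* y :- ν :* ε)) refl x y ε w ν))))

    compound-*-≤ : ∀ {x y ε} → - x ≤ ν → - y ≤ ν → x * y ≤ ν * ε →
      compound x m * compound y m ≤ compound (x + y + ε) m
    compound-*-≤ {x} {y} {ε} -x≤ν -y≤ν xy≤νε = ≤-respˡ (^-distrib-* _ _ (suc m))
      (^-monoˡ-≤ (suc m) (*-nonneg (compound-base-nonneg -x≤ν) (compound-base-nonneg -y≤ν))
        (≤-by (*-nonneg 0≤w (*-nonneg 0≤w (diff-nonneg xy≤νε)))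
          (trans (solve 4 (λ a w p q → a := (a :+ w :* (w :* (p :- q))) :+ w :* (w :* (q :- p))) refl
                   (1# + (x + y + ε) / ν) w (x * y) (ν * ε))
            (+-congʳ (sym (base-* x y ε))))))

    compound-≤-* : ∀ {x y ε} → - (x + y + ε) ≤ ν → ν * ε ≤ x * y →
      compound (x + y + ε) m ≤ compound x m * compound y m
    compound-≤-* {x} {y} {ε} -z≤ν νε≤xy = ≤-respʳ (^-distrib-* _ _ (suc m))
      (^-monoˡ-≤ (suc m) (compound-base-nonneg -z≤ν)
        (≤-by (*-nonneg 0≤w (*-nonneg 0≤w (diff-nonneg νε≤xy))) (base-* x y ε)))

  ≤-suc : ∀ {z n m} → z ≤ fromℕ n → n ℕ.≤ m → z ≤ fromℕ (suc m)
  ≤-suc {z} {n} {m} z≤n n≤m = ≤-trans z≤n (fromℕ-mono-≤ (ℕ.m≤n⇒m≤1+n n≤m))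

  1+x≤exp : ∀ x → 1# + x ≤ exp x
  1+x≤exp x = archimedean-≤ (- x) λ N -x≤N →
    lim-lower N (exp-def x) λ m N≤m → 1+x≤compound m (≤-suc {n = N} -x≤N N≤m)

  exp-nonneg : ∀ x → 0# ≤ exp x
  exp-nonneg x = archimedean-≤ (- x) λ N -x≤N →
    lim-lower N (exp-def x) λ m N≤m → compound-nonneg m (≤-suc {n = N} -x≤N N≤m)

  exp-mono : ∀ {x y} → x ≤ y → exp x ≤ exp y
  exp-mono {x} {y} x≤y = archimedean-≤ (- x) λ N -x≤N →
    lim-mono N (exp-def x) (exp-def y) λ m N≤m → compound-mono m (≤-suc {n = N} -x≤N N≤m) x≤y

  exp-cong : ∀ {x y} → x ≈ y → exp x ≈ exp y
  exp-cong x≈y = ≤-antisym (exp-mono (≤-reflexive x≈y)) (exp-mono (≤-reflexive (sym x≈y)))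

  private
    ≤-*-of-≤-/ : ∀ {p ε ν} → 0# < ε → p * ε ⁻¹ ≤ ν → p ≤ ν * ε
    ≤-*-of-≤-/ {p} {ε} 0<ε p/ε≤ν = ≤-respˡ
      (trans (*-assoc p (ε ⁻¹) ε) (trans (*-congˡ (⁻¹-inverseˡ 0<ε)) (*-identityʳ p)))
      (*-monoʳ-≤ ε (proj₁ 0<ε) p/ε≤ν)

  exp-*-≤ : ∀ x y {ε} → 0# < ε → exp x * exp y ≤ exp (x + y + ε)
  exp-*-≤ x y {ε} 0<ε = archimedean-≤ z λ N z≤N →
    lim-*-≤ N (exp-def x) (exp-def y) (exp-def (x + y + ε)) (exp-nonneg x) (exp-nonneg y) λ m N≤m →
    let z≤ν = ≤-suc {n = N} z≤N N≤m
        -x≤ν = ≤-trans (x≤x⊔y _ _) z≤ν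
        -y≤ν = ≤-trans (≤-trans (x≤x⊔y _ _) (x≤y⊔x (- x) _)) z≤ν
        q≤ν  = ≤-trans (≤-trans (x≤y⊔x (- y) _) (x≤y⊔x (- x) _)) z≤ν
    in compound-nonneg m -x≤ν , compound-nonneg m -y≤ν ,
       compound-*-≤ m -x≤ν -y≤ν (≤-*-of-≤-/ 0<ε q≤ν)
    -- Once ν exceeds z, both bases are nonnegative and x y ≤ ν ε.
    where z = (- x) ⊔ ((- y) ⊔ (x * y * ε ⁻¹))

  exp-≤-* : ∀ x y {ε} → 0# < ε → exp (x + y - ε) ≤ exp x * exp y
  exp-≤-* x y {ε} 0<ε = archimedean-≤ z λ N z≤N →
    lim-≤-* N (exp-def x) (exp-def y) (exp-def (x + y - ε)) (exp-nonneg x) (exp-nonneg y) λ m N≤m →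
    let z≤ν = ≤-suc {n = N} z≤N N≤m
        ν    = fromℕ (suc m)
        -x≤ν = ≤-trans (x≤x⊔y _ _) z≤ν
        -y≤ν = ≤-trans (≤-trans (x≤x⊔y _ _) (x≤y⊔x (- x) _)) z≤ν
        q≤ν  = ≤-trans (≤-trans (≤-trans (x≤x⊔y _ _) (x≤y⊔x (- y) _)) (x≤y⊔x (- x) _)) z≤ν
        -s≤ν = ≤-trans (≤-trans (≤-trans (x≤y⊔x _ _) (x≤y⊔x (- y) _)) (x≤y⊔x (- x) _)) z≤ν
    in compound-nonneg m -x≤ν , compound-nonneg m -y≤ν ,
       compound-≤-* m -s≤ν
         (≤-by (diff-nonneg (≤-*-of-≤-/ {ν = ν} 0<ε q≤ν))
           (solve 4 (λ x y ε ν → x :* y := ν :* (:- ε) :+ (ν :* ε :- (:- (x :* y)))) refl x y ε ν))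
    where z = (- x) ⊔ ((- y) ⊔ ((- (x * y) * ε ⁻¹) ⊔ (- (x + y - ε))))

  -- exp x * exp y lies between exp (x + y − ε) and exp (x + y + ε); letting ε tend to 0
  -- in the bound below on their distance yields exp-+.
  exp-gap : ∀ z {ε} → 0# < ε → ε ≤ 1# →
    exp (z + ε) ≤ exp (z - ε) + ε * (fromℕ 3 * exp (z + 1#))
  exp-gap z {ε} 0<ε ε≤1 = ≤-by
    (+-nonneg (+-nonneg (diff-nonneg contracted)
        (*-nonneg (exp-nonneg (z + ε)) (diff-nonneg (1+x≤exp (- (fromℕ 3 * ε))))))
      (*-nonneg (*-nonneg (fromℕ-nonneg 3) (proj₁ 0<ε))
        (diff-nonneg (exp-mono (+-mono₂-≤ ≤-refl ε≤1)))))
    (solve 5 (λ p q r e ε → q :+ ε :* (con (+ 3) :* r) :=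
        p :+ ((q :- p :* e) :+ p :* (e :- (con (+ 1) :+ (:- (con (+ 3) :* ε)))) :+
          (con (+ 3) :* ε) :* (r :- p))) refl
      (exp (z + ε)) (exp (z - ε)) (exp (z + 1#)) (exp (- (fromℕ 3 * ε))) ε)
    where
    -- The shift from z + ε to z - ε takes 2ε, and `exp-*-≤` costs one more ε, hence the 3. Then 1 -
    -- 3ε ≤ exp (- 3ε) bounds the gap by 3ε exp (z + ε).
    contracted : exp (z + ε) * exp (- (fromℕ 3 * ε)) ≤ exp (z - ε)
    contracted = ≤-trans (exp-*-≤ (z + ε) (- (fromℕ 3 * ε)) 0<ε) (exp-mono (≤-reflexive
      (solve 2 (λ z ε → (z :+ ε) :+ (:- (con (+ 3) :* ε)) :+ ε := z :- ε) refl z ε)))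

  exp-+ : ∀ x y → exp (x + y) ≈ exp x * exp y
  exp-+ x y = ≤-antisym
    (ε-≤ s 0≤s λ ε 0<ε ε≤1 → ≤-trans (exp-mono (≤-by (proj₁ 0<ε) refl))
      (≤-trans (exp-gap (x + y) 0<ε ε≤1) (+-mono-≤ _ (exp-≤-* x y 0<ε))))
    (ε-≤ s 0≤s λ ε 0<ε ε≤1 → ≤-trans (exp-*-≤ x y 0<ε)
      (≤-trans (exp-gap (x + y) 0<ε ε≤1) (+-mono-≤ _ (exp-mono
        (≤-by (proj₁ 0<ε) (solve 2 (λ z ε → z := (z :- ε) :+ ε) refl (x + y) ε))))))
    where
    s   = fromℕ 3 * exp (x + y + 1#)
    0≤s = *-nonneg (fromℕ-nonneg 3) (exp-nonneg (x + y + 1#))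

  exp-0 : exp 0# ≈ 1#
  exp-0 = sym (≤-antisym 1≤e (*-cancelˡ-≤ (<-≤-trans 0<1 1≤e) (≤-reflexive
    (trans (sym (exp-+ 0# 0#)) (trans (exp-cong (+-identityʳ 0#)) (sym (*-identityʳ _)))))))
    where
    1≤e : 1# ≤ exp 0#
    1≤e = ≤-respˡ (+-identityʳ 1#) (1+x≤exp 0#)

  exp-inverse : ∀ x → exp x * exp (- x) ≈ 1#
  exp-inverse x = trans (sym (exp-+ x (- x))) (trans (exp-cong (-‿inverseʳ x)) exp-0)

  exp-pos : ∀ x → 0# < exp x
  exp-pos x = exp-nonneg x , λ 0≈e → 0≉1
    (trans (sym (zeroˡ _)) (trans (*-congʳ 0≈e) (exp-inverse x)))

  exp-fromℕ-* : ∀ n x → exp (fromℕ n * x) ≈ exp x ^ n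
  exp-fromℕ-* zero    x = trans (exp-cong (zeroˡ x)) exp-0
  exp-fromℕ-* (suc n) x = trans
    (exp-cong (solve 2 (λ n x → (con (+ 1) :+ n) :* x := x :+ n :* x) refl (fromℕ n) x))
    (trans (exp-+ x (fromℕ n * x)) (*-congˡ (exp-fromℕ-* n x)))

  -- The tangent bound 1 + x ≤ exp x at x = - ln y, where exp (- ln y) = 1/y. The inverse is any w
  -- with y w = 1, so that for y = c/(c - 1) it can be taken as (c - 1)/c.
  1-y⁻¹≤ln : ∀ {y w} → 0# < y → y * w ≈ 1# → 1# - w ≤ ln y
  1-y⁻¹≤ln {y} {w} 0<y yw≈1 = ≤-by (diff-nonneg (1+x≤exp (- ln y)))
    (trans (solve 3 (λ l e w → l := (con (+ 1) :- w) :+ (e :- (con (+ 1) :+ (:- l))) :+ (w :- e)) refl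
              (ln y) (exp (- ln y)) w)
      (trans (+-congˡ (trans (+-congʳ (sym e≈w)) (-‿inverseʳ _))) (+-identityʳ _)))
    where
    e = exp (- ln y)
    ye≈1 : y * e ≈ 1#
    ye≈1 = trans (*-congʳ (sym (exp-ln y 0<y))) (exp-inverse (ln y))
    e≈w : e ≈ w
    e≈w = trans (sym (*-identityʳ e)) (trans (*-congˡ (sym yw≈1))
      (trans (solve 3 (λ e y w → e :* (y :* w) := (y :* e) :* w) refl e y w)
        (trans (*-congʳ ye≈1) (*-identityˡ w))))

  -- Near 0 the sharp exponent x²/2 leaves no room for 1 + z ≤ exp z, since 1 + x²/2 is already
  -- below cosh x. With x² that inequality settles small x, and doubling the argument reaches the
  -- rest.
  CoshBound : ℝ → Set
  CoshBound x = exp x + exp (- x) ≤ fromℕ 2 * exp (x * x)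

  -- With u = y², exp (2y) (1 − y)² ≤ 1 and exp (− 2y) (1 + y)² ≤ 1 add up to
  -- (1 − u)² (exp (2y) + exp (− 2y)) ≤ 2 (1 + u) ≤ 2 (1 − u)² (1 + 4u).
  cosh-bound-small : ∀ y → fromℕ 8 * (y * y) ≤ 1# → CoshBound (y + y)
  cosh-bound-small y 8u≤1 = ≤-trans
    (*-cancelˡ-≤ (*-pos 0<1-u 0<1-u) bound)
    (*-monoˡ-≤ (fromℕ 2) (fromℕ-nonneg 2) (≤-respˡ
      (+-congˡ (solve 1 (λ y → (y :+ y) :* (y :+ y) := con (+ 4) :* (y :* y)) refl y))
      (1+x≤exp ((y + y) * (y + y)))))
    where
    u = y * y
    0≤u = square-nonneg y
    e  = exp y
    e′ = exp (- y)
    0<1-u : 0# < 1# - u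
    0<1-u = ≰⇒> λ 1-u≤0 → <⇒≱ (fromℕ-mono-< {1} {8} (ℕ.s≤s (ℕ.s≤s ℕ.z≤n)))
      (≤-by (+-nonneg (diff-nonneg 8u≤1) (*-nonneg (fromℕ-nonneg 8) (diff-nonneg 1-u≤0)))
        (trans fromℕ-1 (solve 1 (λ u → con (+ 1) := con (+ 8) :+ ((con (+ 1) :- con (+ 8) :* u) :+
          con (+ 8) :* (con (+ 0) :- (con (+ 1) :- u)))) refl u)))
    u≤1 : y * y ≤ 1# * 1#
    u≤1 = ≤-respʳ (sym (*-identityˡ 1#)) (≤-by (proj₁ 0<1-u)
      (solve 1 (λ u → con (+ 1) := u :+ (con (+ 1) :- u)) refl u))
    y≤1 : y ≤ 1#
    y≤1 = square-cancel-≤ 0≤1 u≤1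
    -y≤1 : - y ≤ 1#
    -y≤1 = square-cancel-≤ 0≤1 (≤-respˡ (solve 1 (λ y → y :* y := (:- y) :* (:- y)) refl y) u≤1)
    ee′ = exp-inverse y
    e[1-y]≤1 : e * (1# - y) ≤ 1#
    e[1-y]≤1 = ≤-respʳ ee′ (*-monoˡ-≤ e (exp-nonneg y) (1+x≤exp (- y)))
    e′[1+y]≤1 : e′ * (1# + y) ≤ 1#
    e′[1+y]≤1 = ≤-respʳ (trans (*-comm e′ e) ee′) (*-monoˡ-≤ e′ (exp-nonneg (- y)) (1+x≤exp y))
    sq : ∀ {p q} → 0# ≤ p → p ≤ 1# → 0# ≤ q → 0# ≤ q * q * (1# - p * p)
    sq 0≤p p≤1 0≤q = *-nonneg (*-nonneg 0≤q 0≤q)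
      (diff-nonneg (≤-respʳ (*-identityˡ 1#) (square-mono-≤ 0≤p p≤1)))
    0≤1-y = diff-nonneg y≤1
    0≤1+y : 0# ≤ 1# + y
    0≤1+y = ≤-respʳ (solve 1 (λ y → con (+ 1) :- (:- y) := con (+ 1) :+ y) refl y) (diff-nonneg -y≤1)
    bound : (1# - u) * (1# - u) * (exp (y + y) + exp (- (y + y))) ≤
            (1# - u) * (1# - u) * (fromℕ 2 * (1# + fromℕ 4 * u))
    bound = ≤-by
      (+-nonneg (+-nonneg
        (sq (*-nonneg (exp-nonneg y) 0≤1-y) e[1-y]≤1 0≤1+y)
        (sq (*-nonneg (exp-nonneg (- y)) 0≤1+y) e′[1+y]≤1 0≤1-y))
        -- The excess 2 (1 - u)² (1 + 4u) - 2 (1 + u) equals 2u (1 - 7u + 4u²), nonnegative by 8u ≤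
        -- 1.
        (*-nonneg (fromℕ-nonneg 2) (*-nonneg 0≤u
          (+-nonneg (+-nonneg (diff-nonneg 8u≤1) 0≤u) (*-nonneg (fromℕ-nonneg 4) (*-nonneg 0≤u 0≤u))))))
      (trans (solve 3 (λ y e e′ →
          let u = y :* y ; one = con (+ 1) in
          (one :- u) :* (one :- u) :* (con (+ 2) :* (one :+ con (+ 4) :* u)) :=
          (one :- u) :* (one :- u) :* (e :* e :+ e′ :* e′) :+
          ((one :+ y) :* (one :+ y) :* (one :- (e :* (one :- y)) :* (e :* (one :- y))) :+
           (one :- y) :* (one :- y) :* (one :- (e′ :* (one :+ y)) :* (e′ :* (one :+ y))) :+
           con (+ 2) :* (u :* ((one :- con (+ 8) :* u) :+ u :+ con (+ 4) :* (u :* u))))) refl y e e′)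
        (+-congʳ (*-congˡ (+-cong (sym (exp-+ y y)) (trans (sym (exp-+ (- y) (- y)))
          (exp-cong (solve 1 (λ y → :- y :+ :- y := :- (y :+ y)) refl y)))))))

  -- cosh (2y) = 2 cosh² y − 1 and 2 q² − 1 ≤ q⁴.
  cosh-bound-double : ∀ y → CoshBound y → CoshBound (y + y)
  cosh-bound-double y bound = ≤-by
    (+-nonneg (diff-nonneg (square-mono-≤ (+-nonneg (exp-nonneg y) (exp-nonneg (- y))) bound))
      (*-nonneg (fromℕ-nonneg 2) (square-nonneg (q * q - 1#))))
    (trans (*-congˡ q⁴) (trans
      (solve 3 (λ q e e′ → let q² = q :* q in con (+ 2) :* (q² :* q²) :=
         ((e :* e :+ e′ :* e′) :+ (((con (+ 2) :* q) :* (con (+ 2) :* q) :- (e :+ e′) :* (e :+ e′)) :+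
           con (+ 2) :* ((q² :- con (+ 1)) :* (q² :- con (+ 1)))) :+ con (+ 2) :* (e :* e′ :- con (+ 1))))
         refl q e e′)
      (trans (+-cong (+-congʳ (+-cong (sym (exp-+ y y)) (trans (sym (exp-+ (- y) (- y)))
          (exp-cong (solve 1 (λ y → :- y :+ :- y := :- (y :+ y)) refl y)))))
          (trans (*-congˡ (trans (+-congʳ (exp-inverse y)) (-‿inverseʳ 1#))) (zeroʳ _)))
        (+-identityʳ _))))
    where
    q  = exp (y * y)
    e  = exp y
    e′ = exp (- y)
    q⁴ : exp ((y + y) * (y + y)) ≈ (q * q) * (q * q)
    q⁴ = trans (exp-cong (solve 1 (λ y → (y :+ y) :* (y :+ y) :=
             (y :* y :+ y :* y) :+ (y :* y :+ y :* y)) refl y))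
           (trans (exp-+ _ _) (*-cong (exp-+ _ _) (exp-+ _ _)))

  2⁻¹ : ℝ
  2⁻¹ = fromℕ 2 ⁻¹

  0<2 : 0# < fromℕ 2
  0<2 = fromℕ-pos {2} (ℕ.s≤s ℕ.z≤n)

  halves : ∀ x → x * 2⁻¹ + x * 2⁻¹ ≈ x
  halves x = trans (solve 2 (λ x w → x :* w :+ x :* w := x :* (con (+ 2) :* w)) refl x 2⁻¹)
    (trans (*-congˡ (⁻¹-inverseʳ 0<2)) (*-identityʳ x))

  CoshBound-resp : ∀ {x y} → x ≈ y → CoshBound x → CoshBound y
  CoshBound-resp x≈y = ≤-respˡ (+-cong (exp-cong x≈y) (exp-cong (-‿cong x≈y))) ∘
    ≤-respʳ (*-congˡ (exp-cong (*-cong x≈y x≈y)))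

  -- Here n only measures how often x may be halved. Halving divides 2x² by four, and 2 + n ≤ 4 (1 +
  -- n) lets the bound drop by one; at n = 0 it is the range of `cosh-bound-small`.
  cosh-bound-upto : ∀ n x → fromℕ 2 * (x * x) ≤ 1# + fromℕ n → CoshBound x
  cosh-bound-upto n x 2xx≤1+n = CoshBound-resp (halves x) (half n 2xx≤1+n)
    where
    y = x * 2⁻¹
    xx≈4yy : x * x ≈ fromℕ 4 * (y * y)
    xx≈4yy = trans (*-cong (sym (halves x)) (sym (halves x)))
      (solve 1 (λ y → (y :+ y) :* (y :+ y) := con (+ 4) :* (y :* y)) refl y)
    half : ∀ n → fromℕ 2 * (x * x) ≤ 1# + fromℕ n → CoshBound (y + y)
    half zero    h = cosh-bound-small y (≤-respʳ (+-identityʳ 1#) (≤-respˡ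
      (trans (*-congˡ xx≈4yy) (solve 1 (λ z → con (+ 2) :* (con (+ 4) :* z) := con (+ 8) :* z) refl (y * y))) h))
    half (suc n) h = cosh-bound-double y (cosh-bound-upto n y
      (*-cancelˡ-≤ (fromℕ-pos {4} (ℕ.s≤s ℕ.z≤n)) (≤-by
        (+-nonneg (diff-nonneg h) (+-nonneg (fromℕ-nonneg 2) (*-nonneg (fromℕ-nonneg 3) (fromℕ-nonneg n))))
        (trans (solve 3 (λ n z q → con (+ 4) :* (con (+ 1) :+ n) :=
            con (+ 4) :* (con (+ 2) :* z) :+ (((con (+ 1) :+ (con (+ 1) :+ n)) :- con (+ 2) :* q) :+
              (con (+ 2) :+ con (+ 3) :* n)) :+ con (+ 2) :* (q :- con (+ 4) :* z)) refl
            (fromℕ n) (y * y) (x * x))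
          (trans (+-congˡ (trans (*-congˡ (trans (+-congʳ xx≈4yy) (-‿inverseʳ _))) (zeroʳ _)))
            (+-identityʳ _))))))

  cosh-bound : ∀ x → CoshBound x
  cosh-bound x = archimedean-≤ (fromℕ 2 * (x * x)) λ n 2xx≤n →
    cosh-bound-upto n x (≤-trans 2xx≤n (≤-by 0≤1 (+-comm 1# (fromℕ n))))

-- Moment generating function and tail on the whole cube

module CubeTails (F : CompleteOrderedField) (E : ExpLnSqrt F) where

  open OrderedField F
  open Exponential F E

  open CompleteOrderedField F
  open ExpLnSqrt E
  open Max (DecTotalOrder.totalOrder decTotalOrder) using (x≤x⊔y; x≤y⊔x)

  ∑ : {S : Set} → List S → (S → ℝ) → ℝ
  ∑ Ω f = foldr _+_ 0# (map f Ω)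

  module _ {S : Set} where

    ∑-++ : ∀ (xs ys : List S) f → ∑ (xs ++ ys) f ≈ ∑ xs f + ∑ ys f
    ∑-++ []       ys f = sym (+-identityˡ _)
    ∑-++ (x ∷ xs) ys f = trans (+-congˡ (∑-++ xs ys f)) (sym (+-assoc _ _ _))

    ∑-map : ∀ {T : Set} (g : T → S) xs f → ∑ (map g xs) f ≡ ∑ xs (f ∘ g)
    ∑-map g []       f = ≡.refl
    ∑-map g (x ∷ xs) f = ≡.cong (λ s → f (g x) + s) (∑-map g xs f)

    ∑-cong : ∀ (xs : List S) {f g} → (∀ x → f x ≈ g x) → ∑ xs f ≈ ∑ xs g
    ∑-cong []       f≈g = refl
    ∑-cong (x ∷ xs) f≈g = +-cong (f≈g x) (∑-cong xs f≈g)

    ∑-*ˡ : ∀ (xs : List S) a f → ∑ xs (λ x → a * f x) ≈ a * ∑ xs f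
    ∑-*ˡ []       a f = sym (zeroʳ a)
    ∑-*ˡ (x ∷ xs) a f = trans (+-congˡ (∑-*ˡ xs a f)) (sym (distribˡ a _ _))

    ∑-nonneg : ∀ (xs : List S) {f} → (∀ x → 0# ≤ f x) → 0# ≤ ∑ xs f
    ∑-nonneg []       0≤f = ≤-refl
    ∑-nonneg (x ∷ xs) 0≤f = +-nonneg (0≤f x) (∑-nonneg xs 0≤f)

    ∑-≤-+length : ∀ (xs : List S) {f g} → (∀ x → f x ≤ g x + 1#) → ∑ xs f ≤ ∑ xs g + fromℕ (length xs)
    ∑-≤-+length []       f≤g+1 = ≤-reflexive (sym (+-identityʳ 0#))
    ∑-≤-+length (x ∷ xs) {f} {g} f≤g+1 = ≤-trans (+-mono₂-≤ (f≤g+1 x) (∑-≤-+length xs f≤g+1))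
      (≤-reflexive (solve 3 (λ a b c → (a :+ con (+ 1)) :+ (b :+ c) := (a :+ b) :+ (con (+ 1) :+ c)) refl
        (g x) (∑ xs g) (fromℕ (length xs))))

    ∑-filter-≤ : ∀ {Q : Pred S 0ℓ} (Q? : Decidable Q) xs {f} → (∀ x → 0# ≤ f x) → ∑ (filter Q? xs) f ≤ ∑ xs f
    ∑-filter-≤ Q? []       0≤f = ≤-refl
    ∑-filter-≤ Q? (x ∷ xs) {f} 0≤f with Q? x
    ... | yes _ = +-mono₂-≤ ≤-refl (∑-filter-≤ Q? xs 0≤f)
    ... | no  _ = ≤-trans (∑-filter-≤ Q? xs 0≤f) (≤-by (0≤f x) (+-comm _ _))

    markov : ∀ {P : Pred S 0ℓ} (P? : Decidable P) xs {f a} → (∀ x → 0# ≤ f x) → (∀ x → P x → a ≤ f x) →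
      fromℕ (length (filter P? xs)) * a ≤ ∑ xs f
    markov P? []       {a = a} 0≤f a≤f = ≤-reflexive (zeroˡ a)
    markov P? (x ∷ xs) {a = a} 0≤f a≤f with P? x
    ... | yes Px = ≤-respˡ (sym (trans (distribʳ a _ _) (+-congʳ (*-identityˡ a))))
                     (+-mono₂-≤ (a≤f x Px) (markov P? xs 0≤f a≤f))
    ... | no  _  = ≤-trans (markov P? xs 0≤f a≤f) (≤-by (0≤f x) (+-comm _ _))

  length-cube : ∀ n → length (cube n) ≡ 2 ℕ.^ n
  length-cube zero    = ≡.refl
  length-cube (suc n) = ≡.trans (length-++ (map (outside ∷_) (cube n)))
    (≡.cong₂ ℕ._+_ (≡.trans (length-map _ (cube n)) (length-cube n))
      (≡.trans (≡.trans (length-map _ (cube n)) (length-cube n)) (≡.sym (ℕ.+-identityʳ _))))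

  ∑-cube-suc : ∀ n f → ∑ (cube (suc n)) f ≈ ∑ (cube n) (f ∘ (outside ∷_)) + ∑ (cube n) (f ∘ (inside ∷_))
  ∑-cube-suc n f = trans (∑-++ (map (outside ∷_) (cube n)) _ f)
    (+-cong (reflexive (∑-map (outside ∷_) (cube n) f)) (reflexive (∑-map (inside ∷_) (cube n) f)))

  size : ℕ → ℝ
  size n = fromℕ (length (cube n))

  size-pos : ∀ n → 0# < size n
  size-pos n = ≡.subst (λ k → 0# < fromℕ k) (≡.sym (length-cube n)) (fromℕ-pos {2 ℕ.^ n} (ℕ.m^n>0 2 n))

  size-suc : ∀ n → size (suc n) ≈ size n + size n
  size-suc n = trans (reflexive (≡.cong fromℕ (≡.trans (length-++ (map (outside ∷_) (cube n)))
      (≡.cong₂ ℕ._+_ (length-map _ (cube n)) (length-map _ (cube n))))))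
    (fromℕ-+ (length (cube n)) (length (cube n)))

  hamming-refl : ∀ {n} (A : Subset n) → hamming A A ≡ 0
  hamming-refl []            = ≡.refl
  hamming-refl (inside  ∷ A) = hamming-refl A
  hamming-refl (outside ∷ A) = hamming-refl A

  module _ {n} {X : Subset n → ℝ} (lip : Lipschitz F X) where

    lipschitz-≤ : ∀ A B {k} → hamming A B ≡ k → X A ≤ X B + fromℕ k
    lipschitz-≤ A B ≡.refl = ≤-by (diff-nonneg (≤-trans (x≤x⊔y _ _) (lip A B)))
      (solve 3 (λ a b h → b :+ h := a :+ (h :- (a :- b))) refl (X A) (X B) (fromℕ (hamming A B)))

  square-≤-1 : ∀ {x} → x ≤ 1# → - x ≤ 1# → x * x ≤ 1#
  square-≤-1 {x} x≤1 -x≤1 = ≤-by (*-nonneg (diff-nonneg x≤1) (diff-nonneg -x≤1))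
    (solve 1 (λ x → con (+ 1) := x :* x :+ (con (+ 1) :- x) :* (con (+ 1) :- (:- x))) refl x)

  -- The two halves given by the first coordinate have means e + d and e - d. Recentring each half
  -- at its own mean produces exp (t d) and exp (- t d), whose sum `cosh-bound` controls. Flipping
  -- the coordinate changes X by at most 1, so ∣2d∣ ≤ 1, and t² ≤ 4q becomes (t d)² ≤ q.
  cube-mgf : ∀ n {X : Subset n → ℝ} {t q e} → Lipschitz F X → t * t ≤ fromℕ 4 * q →
    e * size n ≈ ∑ (cube n) X →
    ∑ (cube n) (λ A → exp (t * (X A - e))) ≤ size n * exp (fromℕ n * q)
  cube-mgf zero {X} {t} {q} {e} lip tt≤4q mean = ≤-reflexive
    (trans (+-identityʳ _) (trans (exp-cong arg≈0)
      (trans (sym (*-identityˡ _)) (*-congʳ (sym fromℕ-1)))))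
    where
    arg≈0 : t * (X [] - e) ≈ 0# * q
    arg≈0 = trans (*-congˡ (trans (+-cong (sym (+-identityʳ _)) (-‿cong (trans (sym (*-identityʳ e))
      (*-congˡ (sym fromℕ-1))))) (trans (+-congˡ (-‿cong mean)) (-‿inverseʳ _))))
      (trans (zeroʳ t) (sym (zeroˡ q)))
  cube-mgf (suc n) {X} {t} {q} {e} lip tt≤4q mean = begin
    ∑ (cube (suc n)) (λ A → exp (t * (X A - e)))
      ≈⟨ ∑-cube-suc n _ ⟩
    ∑ (cube n) (λ A → exp (t * (X₀ A - e))) + ∑ (cube n) (λ A → exp (t * (X₁ A - e)))
      ≈⟨ +-cong (recentre X₀ e₀ (t * d) (*-congˡ (+-congˡ refl)))
                (recentre X₁ e₁ (- (t * d)) e₁-e) ⟩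
    exp (t * d) * ∑ (cube n) (λ A → exp (t * (X₀ A - e₀))) +
    exp (- (t * d)) * ∑ (cube n) (λ A → exp (t * (X₁ A - e₁)))
      ≤⟨ +-mono₂-≤
           (*-monoˡ-≤ _ (exp-nonneg _) (cube-mgf n (λ A B → lip (outside ∷ A) (outside ∷ B)) tt≤4q (centred X₀)))
           (*-monoˡ-≤ _ (exp-nonneg _) (cube-mgf n (λ A B → lip (inside ∷ A) (inside ∷ B)) tt≤4q (centred X₁))) ⟩
    exp (t * d) * (L * exp (fromℕ n * q)) + exp (- (t * d)) * (L * exp (fromℕ n * q))
      ≈⟨ distribʳ _ _ _ ⟨
    (exp (t * d) + exp (- (t * d))) * (L * exp (fromℕ n * q))
      ≤⟨ *-monoʳ-≤ _ (*-nonneg (proj₁ 0<L) (exp-nonneg _)) (≤-trans (cosh-bound (t * d))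
           (*-monoˡ-≤ _ (fromℕ-nonneg 2) (exp-mono td²≤q))) ⟩
    (fromℕ 2 * exp q) * (L * exp (fromℕ n * q))
      ≈⟨ solve 3 (λ a b l → (con (+ 2) :* a) :* (l :* b) := (l :+ l) :* (a :* b)) refl
           (exp q) (exp (fromℕ n * q)) L ⟩
    (L + L) * (exp q * exp (fromℕ n * q))
      ≈⟨ *-cong (sym (size-suc n)) (trans (sym (exp-+ q _)) (exp-cong
           (solve 2 (λ n q → q :+ n :* q := (con (+ 1) :+ n) :* q) refl (fromℕ n) q))) ⟩
    size (suc n) * exp (fromℕ (suc n) * q)
      ∎
    where
    open ≤-R
    X₀ X₁ : Subset n → ℝ
    X₀ A = X (outside ∷ A)
    X₁ A = X (inside ∷ A)
    L = size n
    0<L = size-pos n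
    S₀ = ∑ (cube n) X₀
    S₁ = ∑ (cube n) X₁
    e₀ = S₀ / L
    e₁ = S₁ / L
    d = e₀ - e
    centred : ∀ Y → (∑ (cube n) Y / L) * L ≈ ∑ (cube n) Y
    centred Y = trans (*-assoc _ _ _) (trans (*-congˡ (⁻¹-inverseˡ 0<L)) (*-identityʳ _))
    2e : e + e ≈ e₀ + e₁
    2e = trans (unit (e + e)) (trans (*-congʳ {L ⁻¹} (begin-equality
        (e + e) * L              ≈⟨ solve 2 (λ e l → (e :+ e) :* l := e :* (l :+ l)) refl e L ⟩
        e * (L + L)              ≈⟨ *-congˡ (size-suc n) ⟨
        e * size (suc n)         ≈⟨ mean ⟩
        ∑ (cube (suc n)) X       ≈⟨ ∑-cube-suc n X ⟩
        S₀ + S₁                  ∎)) (distribʳ _ _ _))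
      where
      unit : ∀ x → x ≈ (x * L) * L ⁻¹
      unit x = sym (trans (*-assoc _ _ _) (trans (*-congˡ (⁻¹-inverseʳ 0<L)) (*-identityʳ _)))
    e₁≈ : e₁ ≈ (e + e) - e₀
    e₁≈ = trans (solve 2 (λ a b → b := (a :+ b) :- a) refl e₀ e₁) (+-congʳ (sym 2e))
    e₁-e : t * (e₁ - e) ≈ - (t * d)
    e₁-e = trans (*-congˡ (+-congʳ e₁≈))
      (solve 3 (λ t e a → t :* ((e :+ e) :- a :- e) := :- (t :* (a :- e))) refl t e e₀)
    recentre : ∀ Y a s → t * (a - e) ≈ s →
      ∑ (cube n) (λ A → exp (t * (Y A - e))) ≈ exp s * ∑ (cube n) (λ A → exp (t * (Y A - a)))
    recentre Y a s ta≈s = trans (∑-cong (cube n) λ A → trans (exp-cong (trans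
        (solve 4 (λ t y a e → t :* (y :- e) := t :* (a :- e) :+ t :* (y :- a)) refl t (Y A) a e)
        (+-congʳ ta≈s))) (exp-+ s _))
      (∑-*ˡ (cube n) (exp s) _)
    mean-≤ : ∀ Y Z → (∀ A → Y A ≤ Z A + 1#) → ∑ (cube n) Y / L ≤ ∑ (cube n) Z / L + 1#
    mean-≤ Y Z Y≤Z+1 = ≤-trans (*-monoʳ-≤ (L ⁻¹) (⁻¹-nonneg 0<L) (∑-≤-+length (cube n) Y≤Z+1))
      (≤-reflexive (trans (distribʳ _ _ _) (+-congˡ (⁻¹-inverseʳ 0<L))))
    2d : d + d ≈ e₀ - e₁
    2d = trans (solve 2 (λ a e → (a :- e) :+ (a :- e) := a :- ((e :+ e) :- a)) refl e₀ e)
      (+-congˡ (-‿cong (sym e₁≈)))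
    flip : ∀ A B → hamming A B ≡ 1 → X A ≤ X B + 1#
    flip A B dist = ≤-respʳ (+-congˡ fromℕ-1) (lipschitz-≤ lip A B dist)
    2d≤1 : d + d ≤ 1#
    2d≤1 = ≤-respˡ (sym 2d) (≤-by (diff-nonneg (mean-≤ X₀ X₁ λ A →
        flip (outside ∷ A) (inside ∷ A) (≡.cong suc (hamming-refl A))))
      (solve 2 (λ a b → con (+ 1) := (a :- b) :+ ((b :+ con (+ 1)) :- a)) refl e₀ e₁))
    -2d≤1 : - (d + d) ≤ 1#
    -2d≤1 = ≤-respˡ (-‿cong (sym 2d)) (≤-by (diff-nonneg (mean-≤ X₁ X₀ λ A →
        flip (inside ∷ A) (outside ∷ A) (≡.cong suc (hamming-refl A))))
      (solve 2 (λ a b → con (+ 1) := :- (a :- b) :+ ((a :+ con (+ 1)) :- b)) refl e₀ e₁))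
    td²≤q : (t * d) * (t * d) ≤ q
    td²≤q = *-cancelˡ-≤ (fromℕ-pos {4} (ℕ.s≤s ℕ.z≤n)) (≤-by
      (+-nonneg (diff-nonneg tt≤4q) (*-nonneg (square-nonneg t) (diff-nonneg (square-≤-1 2d≤1 -2d≤1))))
      (solve 3 (λ t d q → con (+ 4) :* q := con (+ 4) :* ((t :* d) :* (t :* d)) :+
        ((con (+ 4) :* q :- t :* t) :+ (t :* t) :* (con (+ 1) :- (d :+ d) :* (d :+ d)))) refl t d q))

  -- The points are taken from an arbitrary part Q of the cube, but the sum of exponentials is
  -- extended to the whole cube, where X is centred. The exponent g may be anything up to h²/n.
  cube-tail : ∀ {n} {X : Subset n → ℝ} {Q : Pred (Subset n) 0ℓ} (Q? : Decidable Q) {h g} →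
    1 ℕ.≤ n → Lipschitz F X → 0# ≤ h → g * fromℕ n ≤ h * h →
    fromℕ (length (filter (λ A → h ≤? (X A - 𝔼 F (cube n) X)) (filter Q? (cube n)))) * exp g ≤ size n
  cube-tail {n} {X} Q? {h} {g} 1≤n lip 0≤h gn≤hh =
    ≤-trans (*-monoˡ-≤ N (fromℕ-nonneg count) (exp-mono g≤p))
      (*-cancelˡ-≤ (exp-pos p) (begin
        exp p * (N * exp p)
          ≈⟨ solve 2 (λ a b → a :* (b :* a) := b :* (a :* a)) refl (exp p) N ⟩
        N * (exp p * exp p)
          ≈⟨ *-congˡ (trans (sym (exp-+ p p)) (exp-cong
               (solve 2 (λ h w → h :* h :* w :+ h :* h :* w := (con (+ 2) :* h :* w) :* h) refl h w))) ⟩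
        N * exp (t * h)
          ≤⟨ markov _ (filter Q? (cube n)) (λ A → exp-nonneg _) (λ A h≤ → exp-mono (*-monoˡ-≤ t 0≤t h≤)) ⟩
        ∑ (filter Q? (cube n)) (λ A → exp (t * (X A - e)))
          ≤⟨ ∑-filter-≤ Q? (cube n) (λ A → exp-nonneg _) ⟩
        ∑ (cube n) (λ A → exp (t * (X A - e)))
          ≤⟨ cube-mgf n lip tt≤4q mean ⟩
        size n * exp (fromℕ n * (h * w * (h * w)))
          ≈⟨ *-congˡ (exp-cong (trans
               (solve 3 (λ n h w → n :* (h :* w :* (h :* w)) := h :* h :* w :* (n :* w)) refl (fromℕ n) h w)
               (trans (*-congˡ nw≈1) (*-identityʳ p)))) ⟩
        size n * exp p
          ≈⟨ *-comm _ _ ⟩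
        exp p * size n
          ∎))
    where
    open ≤-R
    e = 𝔼 F (cube n) X
    count = length (filter (λ A → h ≤? (X A - 𝔼 F (cube n) X)) (filter Q? (cube n)))
    N = fromℕ count
    0<n = fromℕ-pos {n} 1≤n
    w = fromℕ n ⁻¹
    nw≈1 = ⁻¹-inverseʳ 0<n
    p = h * h * w
    -- The minimiser 2h/n of n t²/4 - t h. Markov's inequality yields exp (t h) = exp p · exp p, the
    -- moment bound costs exp p, and one factor remains.
    t = fromℕ 2 * h * w
    0≤t = *-nonneg (*-nonneg (fromℕ-nonneg 2) 0≤h) (⁻¹-nonneg 0<n)
    g≤p : g ≤ p
    g≤p = ≤-respˡ (trans (*-assoc g _ _) (trans (*-congˡ nw≈1) (*-identityʳ g)))
      (*-monoʳ-≤ w (⁻¹-nonneg 0<n) gn≤hh)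
    tt≤4q : t * t ≤ fromℕ 4 * (h * w * (h * w))
    tt≤4q = ≤-reflexive (solve 2 (λ h w → (con (+ 2) :* h :* w) :* (con (+ 2) :* h :* w) :=
      con (+ 4) :* (h :* w :* (h :* w))) refl h w)
    mean : e * size n ≈ ∑ (cube n) X
    mean = trans (*-assoc _ _ _) (trans (*-congˡ (⁻¹-inverseˡ (size-pos n))) (*-identityʳ _))

-- Lower bounds for the levels near the middle

module Levels (F : CompleteOrderedField) where

  open OrderedField F
  open Binomials

  open CompleteOrderedField F
  open SemiringExp semiring using (^-homo-*)

  fromℕ-^ : ∀ m k → fromℕ (m ℕ.^ k) ≈ fromℕ m ^ k
  fromℕ-^ m zero    = fromℕ-1
  fromℕ-^ m (suc k) = trans (fromℕ-* m (m ℕ.^ k)) (*-congˡ (fromℕ-^ m k))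

  geometric : ∀ {g : ℕ → ℝ} {b} → 0# ≤ b → ∀ j i →
    (∀ t → i ℕ.≤ t → t ℕ.< j ℕ.+ i → g (suc t) ≤ b * g t) → g (j ℕ.+ i) ≤ b ^ j * g i
  geometric         0≤b zero    i step = ≤-reflexive (sym (*-identityˡ _))
  geometric {b = b} 0≤b (suc j) i step = ≤-trans (step (j ℕ.+ i) (ℕ.m≤n+m i j) ℕ.≤-refl)
    (≤-respʳ (sym (*-assoc _ _ _)) (*-monoˡ-≤ b 0≤b
      (geometric 0≤b j i λ t i≤t t<j+i → step t i≤t (ℕ.m≤n⇒m≤1+n t<j+i))))

  -- A downward search for ⌊x/2⌋ from an explicit bound N, since `archimedean` provides no witness
  -- to start from.
  floor-half : ∀ N {x} → 0# ≤ x → x < fromℕ 2 * fromℕ N →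
    ∃[ K ] fromℕ 2 * fromℕ K ≤ x × x ≤ fromℕ 2 * fromℕ (suc K)
  floor-half zero    0≤x x<0 = contradiction 0≤x (<⇒≱ (<-≤-trans x<0 (≤-reflexive (zeroʳ _))))
  floor-half (suc N) {x} 0≤x x<2N with fromℕ 2 * fromℕ N ≤? x
  ... | yes 2N≤x = N , 2N≤x , proj₁ x<2N
  ... | no  2N≰x = floor-half N 0≤x (≰⇒> 2N≰x)

  h+h≤n : ∀ {h n} → HalfOf h n → h ℕ.+ h ℕ.≤ n
  h+h≤n even = ℕ.≤-refl
  h+h≤n odd  = ℕ.n≤1+n _

  n≤1+h+h : ∀ {h n} → HalfOf h n → n ℕ.≤ suc (h ℕ.+ h)
  n≤1+h+h even = ℕ.n≤1+n _
  n≤1+h+h odd  = ℕ.≤-refl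

  -- The two conditions on R are cleared of quotients, √ and ln, so that both statements of the
  -- theorem can supply them.
  module _ (n : ℕ) (c R : ℝ) (2≤c : fromℕ 2 ≤ c) (0≤R : 0# ≤ R)
    (R-upper : fromℕ 2 * (c + 1#) * R ≤ (c - 1#) * fromℕ n)
    (R-lower : fromℕ n ≤ c * (R * R)) where

    private
      ν = fromℕ n
      0≤ν = fromℕ-nonneg n
      f : ℕ → ℝ
      f i = fromℕ (n C i)
      0≤f : ∀ i → 0# ≤ f i
      0≤f i = fromℕ-nonneg (n C i)

      1≤c : 1# ≤ c
      1≤c = ≤-trans (≤-respˡ fromℕ-1 (fromℕ-mono-≤ {1} {2} (ℕ.s≤s ℕ.z≤n))) 2≤c
      0<c = <-≤-trans 0<1 1≤c
      0≤c = proj₁ 0<c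
      0≤c-1 = diff-nonneg 1≤c
      0<1+ : ∀ i → 0# < fromℕ (suc i)
      0<1+ i = fromℕ-pos {suc i} (ℕ.s≤s ℕ.z≤n)

    -- By c - 1 ≤ c + 1. It confines all admissible levels to the range from 0 to n.
    2R≤n : fromℕ 2 * R ≤ fromℕ n
    2R≤n = *-cancelˡ-≤ (<-≤-trans 0<1 (≤-by 0≤c (+-comm c 1#)))
      (≤-by (+-nonneg (diff-nonneg R-upper) (*-nonneg (fromℕ-nonneg 2) 0≤ν))
        (solve 3 (λ c r n → (c :+ con (+ 1)) :* n := (c :+ con (+ 1)) :* (con (+ 2) :* r) :+
          (((c :- con (+ 1)) :* n :- con (+ 2) :* (c :+ con (+ 1)) :* r) :+ con (+ 2) :* n)) refl c R ν))

    private
      ratio : ∀ i → fromℕ (suc i) * f (suc i) ≈ (ν - fromℕ i) * f i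
      ratio i = trans (solve 3 (λ a x y → a :* x := (a :* x :+ a :* y) :- a :* y) refl (fromℕ (suc i)) (f (suc i)) (f i))
        (trans (+-congʳ (trans (+-cong (sym (fromℕ-* (suc i) (n C suc i))) (sym (fromℕ-* (suc i) (n C i))))
            (trans (sym (fromℕ-+ (suc i ℕ.* (n C suc i)) (suc i ℕ.* (n C i))))
              (trans (reflexive (≡.cong fromℕ (C-ratio n i))) (fromℕ-* (suc n) (n C i))))))
          (solve 3 (λ n i y → (con (+ 1) :+ n) :* y :- (con (+ 1) :+ i) :* y := (n :- i) :* y) refl ν (fromℕ i) (f i)))

      -- For i ≥ n/2 - R the ratio (n - i)/(i + 1) is at most c, because `R-upper` says n/2 + R ≤ c
      -- (n/2 - R).
      coarse-step : ∀ i → ν ≤ fromℕ 2 * fromℕ i + fromℕ 2 * R → f (suc i) ≤ c * f i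
      coarse-step i ν≤2i+2R = *-cancelˡ-≤ (0<1+ i) (≤-trans (≤-reflexive (ratio i))
        (≤-respʳ (solve 3 (λ c a y → (c :* a) :* y := a :* (c :* y)) refl c (fromℕ (suc i)) (f i))
          (*-monoʳ-≤ (f i) (0≤f i) ν-i≤c[1+i])))
        where
        ν-i≤c[1+i] : ν - fromℕ i ≤ c * fromℕ (suc i)
        ν-i≤c[1+i] = *-cancelˡ-≤ (0<1+ 1) (≤-by
          (+-nonneg (+-nonneg (diff-nonneg R-upper)
            (*-nonneg (≤-trans 0≤1 (≤-by 0≤c (+-comm c 1#))) (diff-nonneg ν≤2i+2R))) (*-nonneg (fromℕ-nonneg 2) 0≤c))
          (solve 4 (λ c n i r → con (+ 2) :* (c :* (con (+ 1) :+ i)) := con (+ 2) :* (n :- i) :+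
             (((c :- con (+ 1)) :* n :- con (+ 2) :* (c :+ con (+ 1)) :* r) :+
              (c :+ con (+ 1)) :* ((con (+ 2) :* i :+ con (+ 2) :* r) :- n) :+ con (+ 2) :* c)) refl
             c ν (fromℕ i) R))

      -- Within R/2 of the middle the ratio is at most (3c + 1)/(c + 3), which is at
      -- most √c because c (c + 3)² − (3c + 1)² = (c − 1)³.
      fine-step : ∀ i → i ℕ.≤ n → ν ≤ fromℕ 2 * fromℕ i + 1# + R →
        f (suc i) * f (suc i) ≤ c * (f i * f i)
      fine-step i i≤n ν≤2i+1+R = *-cancelˡ-≤ (*-pos (0<1+ i) (0<1+ i)) (begin
        (q * q) * (f (suc i) * f (suc i))   ≈⟨ solve 2 (λ q x → (q :* q) :* (x :* x) := (q :* x) :* (q :* x)) refl q (f (suc i)) ⟩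
        (q * f (suc i)) * (q * f (suc i))   ≈⟨ *-cong (ratio i) (ratio i) ⟩
        (p * f i) * (p * f i)               ≈⟨ solve 2 (λ p x → (p :* x) :* (p :* x) := (p :* p) :* (x :* x)) refl p (f i) ⟩
        (p * p) * (f i * f i)               ≤⟨ *-monoʳ-≤ _ (square-nonneg (f i)) pp≤cqq ⟩
        (c * (q * q)) * (f i * f i)         ≈⟨ solve 3 (λ c q x → (c :* q) :* x := q :* (c :* x)) refl c (q * q) (f i * f i) ⟩
        (q * q) * (c * (f i * f i))         ∎)
        where
        open ≤-R
        p = ν - fromℕ i
        q = fromℕ (suc i)
        0≤p = diff-nonneg (fromℕ-mono-≤ i≤n)
        c+3 = c + fromℕ 3
        0<c+3 = <-≤-trans 0<c (≤-by (fromℕ-nonneg 3) refl)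
        linear : c+3 * p ≤ (fromℕ 3 * c + 1#) * q
        linear = ≤-by
          (+-nonneg (+-nonneg (diff-nonneg R-upper)
            (*-nonneg (*-nonneg (fromℕ-nonneg 2) (≤-trans 0≤1 (≤-by 0≤c (+-comm c 1#)))) (diff-nonneg ν≤2i+1+R)))
            0≤c-1)
          (solve 4 (λ c n i r → (con (+ 3) :* c :+ con (+ 1)) :* (con (+ 1) :+ i) :=
             (c :+ con (+ 3)) :* (n :- i) :+
             (((c :- con (+ 1)) :* n :- con (+ 2) :* (c :+ con (+ 1)) :* r) :+
              (con (+ 2) :* (c :+ con (+ 1))) :* ((con (+ 2) :* i :+ con (+ 1) :+ r) :- n) :+ (c :- con (+ 1))))
             refl c ν (fromℕ i) R)
        pp≤cqq : p * p ≤ c * (q * q)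
        pp≤cqq = *-cancelˡ-≤ (*-pos 0<c+3 0<c+3) (≤-by
          (+-nonneg (diff-nonneg (square-mono-≤ (*-nonneg (proj₁ 0<c+3) 0≤p) linear))
            (*-nonneg (*-nonneg 0≤c-1 (*-nonneg 0≤c-1 0≤c-1)) (square-nonneg q)))
          (solve 3 (λ c p q → let k = c :+ con (+ 3) ; l = con (+ 3) :* c :+ con (+ 1) ; d = c :- con (+ 1) in
            (k :* k) :* (c :* (q :* q)) := (k :* k) :* (p :* p) :+
            (((l :* q) :* (l :* q) :- (k :* p) :* (k :* p)) :+ (d :* (d :* d)) :* (q :* q))) refl c p q))

    private
      module Descent (s m : ℕ) (half-n : HalfOf (m ℕ.+ s) n)
        (s-near : ν ≤ fromℕ 2 * fromℕ s + fromℕ 2 * R)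
        (K : ℕ) (2K≤R : fromℕ 2 * fromℕ K ≤ R) (R≤2[1+K] : R ≤ fromℕ 2 * fromℕ (suc K)) where

        h = m ℕ.+ s
        H = f h

        m≤R : fromℕ m ≤ R
        m≤R = *-cancelˡ-≤ (0<1+ 1) (≤-by
          (+-nonneg (diff-nonneg s-near) (diff-nonneg (fromℕ-mono-≤ (h+h≤n half-n))))
          (trans (solve 4 (λ r m s n → con (+ 2) :* r := con (+ 2) :* m :+
                (((con (+ 2) :* s :+ con (+ 2) :* r) :- n) :+ (n :- ((m :+ s) :+ (m :+ s))))) refl
              R (fromℕ m) (fromℕ s) ν)
            (+-congˡ (+-congˡ (+-congˡ (-‿cong (sym (trans (fromℕ-+ h h)
              (+-cong (fromℕ-+ m s) (fromℕ-+ m s))))))))))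

        K≤R : fromℕ K ≤ R
        K≤R = ≤-trans (≤-by (fromℕ-nonneg K) (solve 1 (λ k → con (+ 2) :* k := k :+ k) refl (fromℕ K))) 2K≤R

        coarse : ∀ i j → s ℕ.≤ i → f (j ℕ.+ i) ≤ c ^ j * f i
        coarse i j s≤i = geometric {f} 0≤c j i λ t i≤t _ → coarse-step t (≤-trans s-near
          (+-mono-≤ _ (*-monoˡ-≤ (fromℕ 2) (fromℕ-nonneg 2) (fromℕ-mono-≤ (ℕ.≤-trans s≤i i≤t)))))

        fine : ∀ j i → j ℕ.≤ K → j ℕ.+ i ≡ h → H * H ≤ c ^ j * (f i * f i)
        fine j i j≤K j+i≡h = ≡.subst (λ z → f z * f z ≤ c ^ j * (f i * f i)) j+i≡h
          (geometric {λ t → f t * f t} 0≤c j i λ t i≤t t<j+i → fine-step t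
            (ℕ.≤-trans (ℕ.<⇒≤ t<j+i) (ℕ.≤-trans (ℕ.≤-reflexive j+i≡h)
              (ℕ.≤-trans (ℕ.m≤m+n h h) (h+h≤n half-n))))
            (near t i≤t))
          where
          -- At most K steps below h, 2t + R ≥ 2 (h - K) + 2K = 2h; the summand 1 covers odd n = 2h
          -- + 1.
          near : ∀ t → i ℕ.≤ t → ν ≤ fromℕ 2 * fromℕ t + 1# + R
          near t i≤t = ≤-trans (fromℕ-mono-≤ (n≤1+h+h half-n)) (≤-by
            (+-nonneg (+-nonneg (diff-nonneg 2K≤R) (*-nonneg (fromℕ-nonneg 2) (diff-nonneg (fromℕ-mono-≤ i≤t))))
              (*-nonneg (fromℕ-nonneg 2) (diff-nonneg (fromℕ-mono-≤ j≤K))))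
            (trans (solve 5 (λ t r k i j → con (+ 2) :* t :+ con (+ 1) :+ r :=
                (con (+ 1) :+ ((j :+ i) :+ (j :+ i))) :+
                  ((r :- con (+ 2) :* k) :+ con (+ 2) :* (t :- i) :+ con (+ 2) :* (k :- j))) refl
                (fromℕ t) R (fromℕ K) (fromℕ i) (fromℕ j))
              (+-congʳ (+-congˡ (trans (+-cong j+i j+i) (sym (fromℕ-+ h h)))))))
            where
            j+i : fromℕ j + fromℕ i ≈ fromℕ h
            j+i = trans (sym (fromℕ-+ j i)) (reflexive (≡.cong fromℕ j+i≡h))

        -- P is the larger of m and K. Up to K of the m steps between s and the middle multiply the
        -- square by c, the others by c². Compared with c² for each of P steps this saves c^K, which
        -- stands on the left.
        descent : ∃[ P ] fromℕ P ≤ R × c ^ K * (H * H) ≤ (c ^ P * f s) * (c ^ P * f s)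
        descent with ℕ.≤-total m K
        ... | inj₁ m≤K = K , K≤R , (begin
          c ^ K * (H * H)                       ≤⟨ *-monoˡ-≤ _ (^-nonneg K 0≤c) (fine m s m≤K ≡.refl) ⟩
          c ^ K * (c ^ m * (f s * f s))
            ≤⟨ *-monoˡ-≤ _ (^-nonneg K 0≤c) (*-monoʳ-≤ _ (square-nonneg (f s)) c^m≤c^K) ⟩
          c ^ K * (c ^ K * (f s * f s))         ≈⟨ solve 2 (λ a x → a :* (a :* (x :* x)) := (a :* x) :* (a :* x)) refl (c ^ K) (f s) ⟩
          (c ^ K * f s) * (c ^ K * f s)         ∎)
          where
          open ≤-R
          c^m≤c^K : c ^ m ≤ c ^ K
          c^m≤c^K = ≤-trans (≤-respˡ (*-identityˡ _) (*-monoʳ-≤ (c ^ m) (^-nonneg m 0≤c) (1≤^ (K ℕ.∸ m) 1≤c)))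
            (≤-reflexive (trans (sym (^-homo-* c (K ℕ.∸ m) m)) (reflexive (≡.cong (λ z → c ^ z) (ℕ.m∸n+n≡m m≤K)))))
        ... | inj₂ K≤m = m , m≤R , (begin
          c ^ K * (H * H)
            ≤⟨ *-monoˡ-≤ _ (^-nonneg K 0≤c) (fine K (j ℕ.+ s) ℕ.≤-refl K+j+s≡h) ⟩
          c ^ K * (c ^ K * (f (j ℕ.+ s) * f (j ℕ.+ s)))
            ≤⟨ *-monoˡ-≤ _ (^-nonneg K 0≤c) (*-monoˡ-≤ _ (^-nonneg K 0≤c) (square-mono-≤ (0≤f (j ℕ.+ s)) (coarse s j ℕ.≤-refl))) ⟩
          c ^ K * (c ^ K * ((c ^ j * f s) * (c ^ j * f s)))
            ≈⟨ solve 3 (λ a b x → a :* (a :* ((b :* x) :* (b :* x))) := ((a :* b) :* x) :* ((a :* b) :* x)) refl (c ^ K) (c ^ j) (f s) ⟩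
          (c ^ K * c ^ j * f s) * (c ^ K * c ^ j * f s)
            ≈⟨ *-cong (*-congʳ c^K*c^j) (*-congʳ c^K*c^j) ⟩
          (c ^ m * f s) * (c ^ m * f s)         ∎)
          where
          open ≤-R
          j = m ℕ.∸ K
          K+j≡m : K ℕ.+ j ≡ m
          K+j≡m = ℕ.m+[n∸m]≡n K≤m
          K+j+s≡h : K ℕ.+ (j ℕ.+ s) ≡ h
          K+j+s≡h = ≡.trans (≡.sym (ℕ.+-assoc K j s)) (≡.cong (ℕ._+ s) K+j≡m)
          c^K*c^j : c ^ K * c ^ j ≈ c ^ m
          c^K*c^j = trans (sym (^-homo-* c K j)) (reflexive (≡.cong (λ z → c ^ z) K+j≡m))

        -- From n ≤ c R² and R ≤ 2 (K + 1), with 2 ≤ c for the constant term, 2 (n + 1) ≤ c (8 (K +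
        -- 1)² + 1), and the second factor is below 2^(5 + K) ≤ c^(5 + K). The 6 is twice the 3 of R
        -- + 3; K is the saving of `descent`.
        2[1+n]<c^[6+K] : fromℕ (2 ℕ.* suc n) < c ^ (6 ℕ.+ K)
        2[1+n]<c^[6+K] = ≤-<-trans (≤-reflexive (fromℕ-* 2 (suc n))) (≤-<-trans (≤-by
            (+-nonneg (+-nonneg
              (*-nonneg (fromℕ-nonneg 2) (diff-nonneg R-lower))
              (*-nonneg (*-nonneg (fromℕ-nonneg 2) 0≤c) (diff-nonneg (square-mono-≤ 0≤R R≤2[1+K]))))
              (diff-nonneg 2≤c))
            (solve 4 (λ c n r k → let l = con (+ 2) :* k in
              c :* (con (+ 8) :* (k :* k) :+ con (+ 1)) := con (+ 2) :* (con (+ 1) :+ n) :+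
                (con (+ 2) :* (c :* (r :* r) :- n) :+ con (+ 2) :* c :* (l :* l :- r :* r) :+ (c :- con (+ 2)))) refl
              c ν R κ))
          (*-monoˡ-< c 0<c (<-≤-trans
            (≤-<-trans (≤-reflexive nat) (fromℕ-mono-< (8[1+K]²+1<2^[5+K] K)))
            (≤-trans (≤-reflexive (fromℕ-^ 2 (5 ℕ.+ K))) (^-monoˡ-≤ (5 ℕ.+ K) (fromℕ-nonneg 2) 2≤c)))))
          where
          κ = fromℕ (suc K)
          nat : fromℕ 8 * (κ * κ) + 1# ≈ fromℕ (8 ℕ.* (suc K ℕ.* suc K) ℕ.+ 1)
          nat = sym (trans (fromℕ-+ (8 ℕ.* (suc K ℕ.* suc K)) 1)
            (+-cong (trans (fromℕ-* 8 (suc K ℕ.* suc K)) (*-congˡ (fromℕ-* (suc K) (suc K)))) fromℕ-1))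

        level-large : ∃[ P ] fromℕ P ≤ R × fromℕ (2 ℕ.^ n) < c ^ (3 ℕ.+ P) * f s
        level-large with descent
        ... | P , P≤R , c^K*H²≤Y = P , P≤R , square-cancel-< (*-nonneg (^-nonneg (3 ℕ.+ P) 0≤c) (0≤f s))
          -- In c^K 4^n ≤ 2 (n + 1) Y < c^(6 + K) Y the factor c^K cancels, and c⁶ leaves c³ under
          -- the root.
          (*-cancelˡ-< (^-nonneg K 0≤c) (≤-<-trans L²≤ (<-≤-trans (*-monoʳ-< Y 0<Y 2[1+n]<c^[6+K])
            (≤-reflexive (solve 4 (λ c k p x →
                let c³ = λ z → c :* (c :* (c :* z)) in
                c³ (c³ k) :* ((p :* x) :* (p :* x)) := k :* ((c³ p :* x) :* (c³ p :* x))) refl c (c ^ K) (c ^ P) (f s))))))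
          where
          open ≤-R
          L = fromℕ (2 ℕ.^ n)
          Y = (c ^ P * f s) * (c ^ P * f s)
          L²≈4^n : L * L ≈ fromℕ (4 ℕ.^ n)
          L²≈4^n = trans (sym (fromℕ-* (2 ℕ.^ n) (2 ℕ.^ n))) (reflexive (≡.cong fromℕ
            (≡.trans (≡.sym (ℕ.^-distribˡ-+-* 2 n n))
              (≡.trans (≡.cong (λ k → 2 ℕ.^ (n ℕ.+ k)) (≡.sym (ℕ.+-identityʳ n))) (≡.sym (ℕ.^-*-assoc 2 2 n))))))
          L²≤ : c ^ K * (L * L) ≤ fromℕ (2 ℕ.* suc n) * Y
          L²≤ = begin
            c ^ K * (L * L)
              ≤⟨ *-monoˡ-≤ _ (^-nonneg K 0≤c) (≤-trans (≤-reflexive L²≈4^n) (fromℕ-mono-≤ (middle-bound half-n))) ⟩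
            c ^ K * fromℕ (2 ℕ.* suc n ℕ.* ((n C h) ℕ.* (n C h)))
              ≈⟨ *-congˡ (trans (fromℕ-* (2 ℕ.* suc n) ((n C h) ℕ.* (n C h))) (*-congˡ (fromℕ-* (n C h) (n C h)))) ⟩
            c ^ K * (fromℕ (2 ℕ.* suc n) * (H * H))
              ≈⟨ solve 3 (λ a b x → a :* (b :* x) := b :* (a :* x)) refl (c ^ K) (fromℕ (2 ℕ.* suc n)) (H * H) ⟩
            fromℕ (2 ℕ.* suc n) * (c ^ K * (H * H))
              ≤⟨ *-monoˡ-≤ _ (fromℕ-nonneg (2 ℕ.* suc n)) c^K*H²≤Y ⟩
            fromℕ (2 ℕ.* suc n) * Y ∎
          0<L = fromℕ-pos {2 ℕ.^ n} (ℕ.m^n>0 2 n)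
          -- That C(n, s) does not vanish is read off from `L²≤`, whose left side is positive.
          0<Y : 0# < Y
          0<Y = *-cancelˡ-< (fromℕ-nonneg (2 ℕ.* suc n)) (≤-<-trans (≤-reflexive (zeroʳ _))
            (<-≤-trans (*-pos (^-pos K 0<c) (*-pos 0<L 0<L)) L²≤))

      lower-level-large : ∀ {s h} → HalfOf h n → s ℕ.≤ h → ν ≤ fromℕ 2 * fromℕ s + fromℕ 2 * R →
        ∃[ P ] fromℕ P ≤ R × fromℕ (2 ℕ.^ n) < c ^ (3 ℕ.+ P) * f s
      lower-level-large {s} {h} half-n s≤h s-near =
        let K , 2K≤R , R≤2[1+K] = floor-half (suc n) 0≤R (<-≤-trans (R<1+n) (≤-by (fromℕ-nonneg (suc n))
                                    (solve 1 (λ z → con (+ 2) :* z := z :+ z) refl (fromℕ (suc n)))))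
        in Descent.level-large s (h ℕ.∸ s) (≡.subst (λ k → HalfOf k n) (≡.sym (ℕ.m∸n+n≡m s≤h)) half-n) s-near K 2K≤R R≤2[1+K]
        where
        R<1+n : R < fromℕ (suc n)
        R<1+n = ≤-<-trans (≤-trans (≤-by 0≤R (solve 1 (λ r → con (+ 2) :* r := r :+ r) refl R)) 2R≤n)
          (fromℕ-mono-< {n} {suc n} ℕ.≤-refl)

    -- The symmetry C(n, s) = C(n, n - s) carries levels above the middle below it and turns the
    -- upper condition on s into the lower one on n - s.
    level-large : ∀ {s} → s ℕ.≤ n → ν ≤ fromℕ 2 * fromℕ s + fromℕ 2 * R → fromℕ 2 * fromℕ s ≤ ν + fromℕ 2 * R →
      ∃[ P ] fromℕ P ≤ R × fromℕ (2 ℕ.^ n) < c ^ (3 ℕ.+ P) * fromℕ (n C s)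
    level-large {s} s≤n s-near s-near′ with half n
    ... | h , half-n with s ℕ.≤? h
    ...   | yes s≤h = lower-level-large half-n s≤h s-near
    ...   | no  s≰h = ≡.subst (λ b → ∃[ P ] fromℕ P ≤ R × fromℕ (2 ℕ.^ n) < c ^ (3 ℕ.+ P) * fromℕ b)
      (≡.sym (nCk≡nC[n∸k] s≤n)) (lower-level-large half-n n∸s≤h (≤-by (diff-nonneg s-near′)
        (trans (solve 4 (λ a r n s → con (+ 2) :* a :+ con (+ 2) :* r :=
            n :+ ((n :+ con (+ 2) :* r) :- con (+ 2) :* s) :+ con (+ 2) :* ((a :+ s) :- n)) refl
            (fromℕ (n ℕ.∸ s)) R ν (fromℕ s))
          (trans (+-congˡ (trans (*-congˡ (trans (+-congʳ (trans (sym (fromℕ-+ (n ℕ.∸ s) s))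
              (reflexive (≡.cong fromℕ (ℕ.m∸n+n≡m s≤n))))) (-‿inverseʳ ν))) (zeroʳ _)))
            (+-identityʳ _)))))
      where
      n∸s≤h : n ℕ.∸ s ℕ.≤ h
      n∸s≤h = ℕ.m≤n+o⇒m∸n≤o n s (ℕ.≤-trans (n≤1+h+h half-n) (ℕ.+-monoˡ-≤ h (ℕ.≰⇒> s≰h)))

-- Union of the slices and the transfer of the tail bound

module SliceTails (F : CompleteOrderedField) (E : ExpLnSqrt F) where

  open OrderedField F
  open Exponential F E
  open CubeTails F E
  open Levels F
  open Binomials

  open CompleteOrderedField F
  open ExpLnSqrt E
  open SemiringExp semiring using (^-congˡ)
  open Max (DecTotalOrder.totalOrder decTotalOrder) using (x≤x⊔y; x≤y⊔x)

  +-mono-<-≤ : ∀ {x y u v} → x < y → u ≤ v → x + u < y + v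
  +-mono-<-≤ {x} {y} {u} {v} x<y u≤v = ≰⇒> λ y+v≤x+u → <⇒≱ x<y
    (≤-by (+-nonneg (diff-nonneg y+v≤x+u) (diff-nonneg u≤v))
      (solve 4 (λ x y u v → x := y :+ (((x :+ u) :- (y :+ v)) :+ (v :- u))) refl x y u v))

  module _ {n : ℕ} {L G : ℝ} (0≤G : 0# ≤ G) where

    LargeLevel : ℤ → Set
    LargeLevel z = ∃[ s ] z ≡ + s × L < G * fromℕ (n C s)

    private
      card : ∀ {k} → (Fin k → ℤ) → ℝ
      card r = fromℕ (length (slices {n} r))

    mutual

      -- The sum of the level bounds; injectivity of r makes the levels disjoint. With no level only
      -- ≤ holds, so the weak form carries the recursion and one further level makes it strict.
      slices-≥ : ∀ k (r : Fin k → ℤ) → Injective _≡_ _≡_ r → (∀ i → LargeLevel (r i)) → fromℕ k * L ≤ G * card r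
      slices-≥ zero    r inj large = ≤-respˡ (sym (zeroˡ L)) (*-nonneg 0≤G (fromℕ-nonneg (length (slices {n} r))))
      slices-≥ (suc k) r inj large = proj₁ (slices-> k r inj large)

      slices-> : ∀ k (r : Fin (suc k) → ℤ) → Injective _≡_ _≡_ r → (∀ i → LargeLevel (r i)) →
        fromℕ (suc k) * L < G * card r
      slices-> k r inj large with large Fin.zero
      ... | s , r₀≡s , L<GC = <-≤-trans
        (≤-<-trans (≤-reflexive (trans (distribʳ L 1# (fromℕ k)) (+-congʳ (*-identityˡ L))))
          (+-mono-<-≤ L<GC (slices-≥ k (r ∘ Fin.suc) (λ eq → Fin.suc-injective (inj eq)) (large ∘ Fin.suc))))
        (≤-respˡ (distribˡ G _ _) (*-monoˡ-≤ G 0≤G (≤-respˡ (fromℕ-+ (n C s) (length (slices {n} (r ∘ Fin.suc))))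
          (fromℕ-mono-≤ (≡.subst (λ a → a ℕ.+ length (slices {n} (r ∘ Fin.suc)) ℕ.≤ length (slices {n} r))
            (length-level n s first? (λ A eq → ℤ.+-injective (≡.trans eq r₀≡s)) (λ A eq → ≡.trans (≡.cong +_ eq) (≡.sym r₀≡s)))
            (length-filter-disjoint first? (λ A → any? (λ i → (+ ∣ A ∣) ℤ.≟ r (Fin.suc i)))
              (λ A → any? (λ i → (+ ∣ A ∣) ℤ.≟ r i)) (cube n)
              (λ A eq → Fin.zero , eq) (λ A (i , eq) → Fin.suc i , eq)
              (λ A eq (i , eq′) → Fin.0≢1+n (inj (≡.trans (≡.sym eq) eq′)))))))))
        where
        first? = λ A → (+ ∣ A ∣) ℤ.≟ r Fin.zero

  -- The common core of both statements. From count · exp g ≤ 2^n and k 2^n < G · card follows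
  -- count/card < G/(k exp g), and the right side is Z. The quotient is handled by refuting Z ≤ ℙ
  -- after multiplication by card.
  slice-tail : ∀ (c : ℝ) (n : ℕ) (R : ℝ) (k : ℕ) (r : Fin k → ℤ) (X : Subset n → ℝ) →
    fromℕ 2 ≤ c → 2 ℕ.≤ n → 0# ≤ R →
    fromℕ 2 * (c + 1#) * R ≤ (c - 1#) * fromℕ n → fromℕ n ≤ c * (R * R) →
    1 ℕ.≤ k → Injective _≡_ _≡_ r → (∀ i → abs (fromℕ n / fromℕ 2 - fromℤ (r i)) ≤ R) →
    Lipschitz F X → (h : ℝ) → 0# ≤ h →
    ℙ F (slices r) (λ A → h ≤? (X A - 𝔼 F (cube n) X))
      < exp ((R + fromℕ 3) * ln c - ln (fromℕ k) - (h ^ 2) / (fromℕ 2 * (fromℕ n - 1#)))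
  slice-tail c n R (suc k) r X 2≤c 2≤n 0≤R R-upper R-lower 1≤k inj near lip h 0≤h =
    ≰⇒> λ Z≤ℙ → <⇒≱ count<Z*card (≤-respʳ
      (trans (*-assoc _ _ _) (trans (*-congˡ (⁻¹-inverseˡ 0<card)) (*-identityʳ _)))
      (*-monoʳ-≤ card (fromℕ-nonneg (length (slices {n} r))) Z≤ℙ))
    where
    open ≤-R
    ν = fromℕ n
    κ = fromℕ (suc k)
    0<κ = fromℕ-pos {suc k} (ℕ.s≤s ℕ.z≤n)
    count = fromℕ (length (filter (λ A → h ≤? (X A - 𝔼 F (cube n) X)) (slices r)))
    card = fromℕ (length (slices {n} r))
    a = (R + fromℕ 3) * ln c
    G = exp a
    D = fromℕ 2 * (ν - 1#)
    g = (h ^ 2) / D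
    Z = exp (a - ln κ - g)
    n≤D : ν ≤ D
    n≤D = ≤-by (diff-nonneg (fromℕ-mono-≤ 2≤n))
      (solve 1 (λ n → con (+ 2) :* (n :- con (+ 1)) := n :+ (n :- con (+ 2))) refl ν)
    1≤n = ℕ.≤-trans (ℕ.s≤s ℕ.z≤n) 2≤n
    0<D = <-≤-trans (fromℕ-pos {n} 1≤n) n≤D
    0≤g : 0# ≤ g
    0≤g = *-nonneg (*-nonneg 0≤h (*-nonneg 0≤h 0≤1)) (⁻¹-nonneg 0<D)
    gn≤hh : g * ν ≤ h * h
    gn≤hh = ≤-trans (*-monoˡ-≤ g 0≤g n≤D) (≤-reflexive
      (trans (*-assoc _ _ _) (trans (*-congˡ (⁻¹-inverseˡ 0<D)) (trans (*-identityʳ _) (*-congˡ (*-identityʳ h))))))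
    1≤c : 1# ≤ c
    1≤c = ≤-trans (≤-respˡ fromℕ-1 (fromℕ-mono-≤ {1} {2} (ℕ.s≤s ℕ.z≤n))) 2≤c
    0<c = <-≤-trans 0<1 1≤c
    c⁻¹≤1 : c ⁻¹ ≤ 1#
    c⁻¹≤1 = ≤-respˡ (*-identityʳ _) (≤-respʳ (⁻¹-inverseˡ 0<c) (*-monoˡ-≤ (c ⁻¹) (⁻¹-nonneg 0<c) 1≤c))
    0≤ln-c : 0# ≤ ln c
    0≤ln-c = ≤-trans (diff-nonneg c⁻¹≤1) (1-y⁻¹≤ln 0<c (⁻¹-inverseʳ 0<c))
    -- Natural powers of c pass to the real exponent R + 3 here, which takes ln c ≥ 0.
    power-≤-G : ∀ P → fromℕ P ≤ R → c ^ (3 ℕ.+ P) ≤ G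
    power-≤-G P P≤R = begin
      c ^ (3 ℕ.+ P)                  ≈⟨ ^-congˡ (3 ℕ.+ P) (sym (exp-ln c 0<c)) ⟩
      exp (ln c) ^ (3 ℕ.+ P)         ≈⟨ exp-fromℕ-* (3 ℕ.+ P) (ln c) ⟨
      exp (fromℕ (3 ℕ.+ P) * ln c)
        ≤⟨ exp-mono (*-monoʳ-≤ (ln c) 0≤ln-c (≤-respˡ
             (trans (+-comm (fromℕ P) (fromℕ 3)) (sym (fromℕ-+ 3 P))) (+-mono-≤ (fromℕ 3) P≤R))) ⟩
      G ∎
    n/2 : ∀ ρ → fromℕ 2 * (ν / fromℕ 2 - ρ) ≈ ν - fromℕ 2 * ρ
    n/2 ρ = trans (solve 3 (λ n w ρ → con (+ 2) :* (n :* w :- ρ) := n :* (con (+ 2) :* w) :- con (+ 2) :* ρ) refl ν (fromℕ 2 ⁻¹) ρ)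
      (+-congʳ (trans (*-congˡ (⁻¹-inverseʳ 0<2)) (*-identityʳ ν)))
    upper : ∀ i → ν ≤ fromℕ 2 * fromℤ (r i) + fromℕ 2 * R
    upper i = ≤-by (diff-nonneg (≤-respˡ (n/2 (fromℤ (r i)))
        (*-monoˡ-≤ (fromℕ 2) (fromℕ-nonneg 2) (≤-trans (x≤x⊔y _ _) (near i)))))
      (solve 3 (λ n ρ r → con (+ 2) :* ρ :+ con (+ 2) :* r := n :+ (con (+ 2) :* r :- (n :- con (+ 2) :* ρ))) refl ν (fromℤ (r i)) R)
    lower : ∀ i → fromℕ 2 * fromℤ (r i) ≤ ν + fromℕ 2 * R
    lower i = ≤-by (diff-nonneg (*-monoˡ-≤ (fromℕ 2) (fromℕ-nonneg 2) (≤-trans (x≤y⊔x _ _) (near i))))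
      (trans (+-congʳ (trans (solve 2 (λ n ρ → n := (n :- con (+ 2) :* ρ) :+ con (+ 2) :* ρ) refl ν (fromℤ (r i)))
          (+-congʳ (sym (n/2 (fromℤ (r i)))))))
        (solve 3 (λ x ρ r → con (+ 2) :* x :+ con (+ 2) :* ρ :+ con (+ 2) :* r :=
          con (+ 2) :* ρ :+ (con (+ 2) :* r :- con (+ 2) :* (:- x))) refl
          (ν / fromℕ 2 - fromℤ (r i)) (fromℤ (r i)) R))
    2R≤ν = 2R≤n n c R 2≤c 0≤R R-upper R-lower
    large-at : ∀ z → ν ≤ fromℕ 2 * fromℤ z + fromℕ 2 * R → fromℕ 2 * fromℤ z ≤ ν + fromℕ 2 * R →
      LargeLevel {n} {size n} {G} (exp-nonneg a) z
    large-at (+ s) up low with level-large n c R 2≤c 0≤R R-upper R-lower s≤n up low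
      where
      s≤n : s ℕ.≤ n
      s≤n = ℕ.≮⇒≥ λ n<s → <⇒≱ (fromℕ-mono-< n<s) (*-cancelˡ-≤ 0<2
        (≤-by (+-nonneg (diff-nonneg low) (diff-nonneg 2R≤ν))
          (solve 3 (λ n s r → con (+ 2) :* n := con (+ 2) :* s :+ ((n :+ con (+ 2) :* r :- con (+ 2) :* s) :+
            (n :- con (+ 2) :* r))) refl ν (fromℕ s) R)))
    ... | P , P≤R , 2^n< = s , ≡.refl ,
      ≡.subst (λ l → fromℕ l < G * fromℕ (n C s)) (≡.sym (length-cube n))
        (<-≤-trans 2^n< (*-monoʳ-≤ (fromℕ (n C s)) (fromℕ-nonneg (n C s)) (power-≤-G P P≤R)))
    large-at -[1+ s ] up low = contradiction
      (≤-by (+-nonneg (diff-nonneg up) (+-nonneg (diff-nonneg 2R≤ν) (fromℕ-nonneg (suc s))))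
        (solve 3 (λ n s r → con (+ 0) := s :+ ((con (+ 2) :* (:- s) :+ con (+ 2) :* r :- n) :+
          ((n :- con (+ 2) :* r) :+ s))) refl ν (fromℕ (suc s)) R))
      (<⇒≱ (fromℕ-pos {suc s} (ℕ.s≤s ℕ.z≤n)))
    kL<Gcard : κ * size n < G * card
    kL<Gcard = slices-> (exp-nonneg a) k r inj λ i → large-at (r i) (upper i) (lower i)
    -- A strict lower bound for G · card shows that the slices are not empty, so the probability is
    -- a genuine quotient.
    0<card : 0# < card
    0<card = *-cancelˡ-< (exp-nonneg a) (≤-<-trans (≤-reflexive (zeroʳ G))
      (≤-<-trans (proj₁ (*-pos 0<κ (size-pos n))) kL<Gcard))
    Z-split : (κ * exp g) * Z ≈ G
    Z-split = trans (*-congʳ (*-congʳ (sym (exp-ln κ 0<κ)))) (trans (*-congʳ (sym (exp-+ (ln κ) g)))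
      (trans (sym (exp-+ (ln κ + g) (a - ln κ - g)))
        (exp-cong (solve 3 (λ a l g → (l :+ g) :+ (a :- l :- g) := a) refl a (ln κ) g))))
    count<Z*card : count < Z * card
    count<Z*card = *-cancelˡ-< (*-nonneg (proj₁ 0<κ) (exp-nonneg g)) (begin-strict
      (κ * exp g) * count       ≈⟨ solve 3 (λ k e c → (k :* e) :* c := k :* (c :* e)) refl κ (exp g) count ⟩
      κ * (count * exp g)       ≤⟨ *-monoˡ-≤ κ (proj₁ 0<κ) (cube-tail _ 1≤n lip 0≤h gn≤hh) ⟩
      κ * size n                <⟨ kL<Gcard ⟩
      G * card                  ≈⟨ *-congʳ Z-split ⟨
      (κ * exp g) * Z * card    ≈⟨ *-assoc _ _ _ ⟩
      (κ * exp g) * (Z * card)  ∎)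

  -- Squaring √(n l) < R and using l ≥ 1/c gives n ≤ c n l ≤ c R². Leaving l abstract serves both ln
  -- (c/(c - 1)) and ln 2 without transporting `ln` and `√` along 2/(2 - 1) ≈ 2.
  √-lower : ∀ {c l R} n → 0# < c → c ⁻¹ ≤ l → √ (fromℕ n * l) < R → 0# ≤ R × fromℕ n ≤ c * (R * R)
  √-lower {c} {l} {R} n 0<c c⁻¹≤l √<R = ≤-trans 0≤√ (proj₁ √<R) , (begin
    fromℕ n                  ≈⟨ trans (*-congˡ (⁻¹-inverseʳ 0<c)) (*-identityʳ _) ⟨
    fromℕ n * (c * c ⁻¹)     ≈⟨ solve 3 (λ n c w → n :* (c :* w) := c :* (n :* w)) refl (fromℕ n) c (c ⁻¹) ⟩
    c * (fromℕ n * c ⁻¹)     ≤⟨ *-monoˡ-≤ c (proj₁ 0<c) (*-monoˡ-≤ _ (fromℕ-nonneg n) c⁻¹≤l) ⟩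
    c * (fromℕ n * l)        ≈⟨ *-congˡ (√-square _ 0≤nl) ⟨
    c * (√ (fromℕ n * l) * √ (fromℕ n * l))
                             ≤⟨ *-monoˡ-≤ c (proj₁ 0<c) (square-mono-≤ 0≤√ (proj₁ √<R)) ⟩
    c * (R * R)              ∎)
    where
    open ≤-R
    0≤nl = *-nonneg (fromℕ-nonneg n) (≤-trans (⁻¹-nonneg 0<c) c⁻¹≤l)
    0≤√ = √-nonneg _ 0≤nl

  c⁻¹≤ln[c/[c-1]] : ∀ {c} → 1# < c → c ⁻¹ ≤ ln (c / (c - 1#))
  c⁻¹≤ln[c/[c-1]] {c} 1<c = ≤-respˡ
    (trans (solve 2 (λ c w → con (+ 1) :- (c :- con (+ 1)) :* w := w :+ (con (+ 1) :- c :* w)) refl c (c ⁻¹))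
      (trans (+-congˡ (trans (+-congˡ (-‿cong cc⁻¹)) (-‿inverseʳ 1#))) (+-identityʳ _)))
    (1-y⁻¹≤ln 0<y (trans
      (solve 4 (λ c w d v → c :* v :* (d :* w) := (c :* w) :* (d :* v)) refl c (c ⁻¹) (c - 1#) ((c - 1#) ⁻¹))
      (trans (*-cong cc⁻¹ (⁻¹-inverseʳ 0<d)) (*-identityʳ 1#))))
    where
    0<c = ≤-<-trans 0≤1 1<c
    cc⁻¹ = ⁻¹-inverseʳ 0<c
    0<d : 0# < c - 1#
    0<d = ≰⇒> λ c-1≤0 → <⇒≱ 1<c (≤-by (diff-nonneg c-1≤0)
      (solve 1 (λ c → con (+ 1) := c :+ (con (+ 0) :- (c :- con (+ 1)))) refl c))
    0<y : 0# < c / (c - 1#)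
    0<y = *-pos 0<c (*-cancelˡ-< (proj₁ 0<d)
      (≤-<-trans (≤-reflexive (zeroʳ _)) (<-≤-trans 0<1 (≤-reflexive (sym (⁻¹-inverseʳ 0<d))))))

  2⁻¹≤ln2 : fromℕ 2 ⁻¹ ≤ ln (fromℕ 2)
  2⁻¹≤ln2 = ≤-respˡ (trans (+-congʳ (sym (⁻¹-inverseʳ 0<2)))
      (solve 1 (λ w → con (+ 2) :* w :- w := w) refl (fromℕ 2 ⁻¹)))
    (1-y⁻¹≤ln 0<2 (⁻¹-inverseʳ 0<2))

  scale-/ : ∀ {a b x y} → 0# < b → x ≤ (a / b) * y → b * x ≤ a * y
  scale-/ {a} {b} {x} {y} 0<b x≤ = ≤-respʳ
    (trans (solve 4 (λ a b w y → b :* (a :* w :* y) := (b :* w) :* (a :* y)) refl a b (b ⁻¹) y)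
      (trans (*-congʳ (⁻¹-inverseʳ 0<b)) (*-identityˡ _)))
    (*-monoˡ-≤ b (proj₁ 0<b) x≤)

theorem2p6 : (F : CompleteOrderedField) (E : ExpLnSqrt F) →
  let open CompleteOrderedField F
      open ExpLnSqrt E
  in
  ((c : ℝ) (n : ℕ) (R : ℝ) (k : ℕ) (r : Fin k → ℤ) (X : Subset n → ℝ) →
    fromℕ 2 ≤ c →
    3 ℕ.≤ n →
    R < ((c - 1#) / (fromℕ 2 * (c + 1#))) * fromℕ n →
    √ (fromℕ n * ln (c / (c - 1#))) < R →
    1 ℕ.≤ k →
    Injective _≡_ _≡_ r →
    (∀ i → abs (fromℕ n / fromℕ 2 - fromℤ (r i)) ≤ R) →
    Lipschitz F X →
    (h : ℝ) → 0# ≤ h →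
    ℙ F (slices r) (λ A → h ≤? (X A - 𝔼 F (cube n) X))
      < exp ((R + fromℕ 3) * ln c - ln (fromℕ k) - (h ^ 2) / (fromℕ 2 * (fromℕ n - 1#))))
  ×
  ((n : ℕ) (R : ℝ) (k : ℕ) (r : Fin k → ℤ) (X : Subset n → ℝ) →
    3 ℕ.≤ n →
    R < fromℕ n / fromℕ 6 →
    √ (fromℕ n * ln (fromℕ 2)) < R →
    1 ℕ.≤ k →
    Injective _≡_ _≡_ r →
    (∀ i → abs (fromℕ n / fromℕ 2 - fromℤ (r i)) ≤ R) →
    Lipschitz F X →
    (h : ℝ) → 0# ≤ h →
    ℙ F (slices r) (λ A → h ≤? (X A - 𝔼 F (cube n) X))
      < exp ((R + fromℕ 3) * ln (fromℕ 2) - ln (fromℕ k) - (h ^ 2) / (fromℕ 2 * (fromℕ n - 1#))))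
theorem2p6 F E =
  (λ c n R k r X 2≤c 3≤n R< √<R 1≤k inj near lip h 0≤h →
    let 1<c = <-≤-trans (≤-<-trans (≤-reflexive (sym fromℕ-1)) (fromℕ-mono-< {1} {2} ℕ.≤-refl)) 2≤c
        0<c = ≤-<-trans 0≤1 1<c
        0≤R , n≤cRR = √-lower n 0<c (c⁻¹≤ln[c/[c-1]] 1<c) √<R
    in slice-tail c n R k r X 2≤c (ℕ.≤-trans (ℕ.n≤1+n 2) 3≤n) 0≤R
         (scale-/ (*-pos 0<2 (<-≤-trans 0<c (≤-by 0≤1 refl))) (proj₁ R<))
         n≤cRR 1≤k inj near lip h 0≤h) ,
  (λ n R k r X 3≤n R< √<R 1≤k inj near lip h 0≤h →
    let 0≤R , n≤2RR = √-lower n 0<2 2⁻¹≤ln2 √<R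
        6R≤n = scale-/ (fromℕ-pos {6} (ℕ.s≤s ℕ.z≤n)) (≤-trans (proj₁ R<)
                 (≤-reflexive (solve 2 (λ n w → n :* w := (con (+ 1) :* w) :* n) refl (fromℕ n) (fromℕ 6 ⁻¹))))
    in slice-tail (fromℕ 2) n R k r X ≤-refl (ℕ.≤-trans (ℕ.n≤1+n 2) 3≤n) 0≤R
         -- At c = 2 the upper condition 2 (c + 1) R ≤ (c - 1) n reads 6R ≤ n.
         (≤-by (diff-nonneg 6R≤n)
           (solve 2 (λ n r → (con (+ 2) :- con (+ 1)) :* n :=
             con (+ 2) :* (con (+ 2) :+ con (+ 1)) :* r :+ (con (+ 1) :* n :- con (+ 6) :* r)) refl (fromℕ n) R))
         n≤2RR 1≤k inj near lip h 0≤h)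
  where
  open CompleteOrderedField F
  open OrderedField F
  open Exponential F E
  open SliceTails F E
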